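{- Let $\lambda\supseteq\mu$ be partitions, and let $T_1,\dots,T_r$ be all the left snakes of $\lambda/\mu$ (or, alternatively, all the right snakes of $\lambda/\mu$). Then the number of interval sets of $\lambda/\mu$ is $$\mathrm{is}(\lambda/\mu)=\prod_{i=1}^r\left(1+\frac{\ell(T_i)}{2}\right).$$
   Context: Skew diagram $\lambda/\mu=\{(i,j):\mu_i<j\le\lambda_i\}$; square $(i,j)$ is drawn as $[j-1,j]\times[-i,-i+1]$. An outside top corner is $(i,j)\in\lambda/\mu$ with $(i-1,j),(i,j-1)\notin\lambda/\mu$; an inside top corner is $(i,j)\in\lambda/\mu$ with $(i-1,j),(i,j-1)\in\lambda/\mu$, $(i-1,j-1)\notin\lambda/\mu$; the diagonal of a corner $(i,j)$ is the set of $(i+p,j+p)\in\lambda/\mu$, $p\ge0$; $\mathrm{rank}(\lambda/\mu)$ is the number of squares on outside diagonals minus the number on inside diagonals. For a partition $\alpha$, its boundary path goes up $x=0$ from $y=-\infty$ to $(0,-\ell(\alpha))$, follows the lower-right boundary of the diagram of $\alpha$ to $(\alpha_1,0)$, then right along $y=0$; the unit step starting at $(x,y)$ has index $x+y$. For $k\in\mathbb{Z}$ let $e_k$ be step $k$ of the boundary path of $\lambda$. If $e_k$ is also a step of the boundary path of $\mu$, $S_k=\emptyset$. Otherwise, if $e_k$ is horizontal it is the lower edge of a square $(i,j)\in\lambda/\mu$ and $S_k=(\lambda/\mu)\cap\{(i,j),(i,j-1),(i-1,j-1),(i-1,j-2),\dots\}$; if vertical it is the right edge of $(i,j)\in\lambda/\mu$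 and $S_k=(\lambda/\mu)\cap\{(i,j),(i-1,j),(i-1,j-1),(i-2,j-1),\dots\}$. Length $\ell(S_k)=|S_k|-1$. $S_k$ is a left snake if $e_k$ is horizontal and $\ell(S_k)$ is even ($\ge0$), a right snake if $e_k$ is vertical and $\ell(S_k)$ is even. Snake sequence: $q_k=L_m$ if $S_k$ is a left snake of length $2m$, $R_m$ if a right snake of length $2m$, $O$ otherwise. With $r=\mathrm{rank}(\lambda/\mu)$, an interval set of $\lambda/\mu$ is a set $\{(u_1,v_1),\dots,(u_r,v_r)\}$ of pairs of integers, the $2r$ integers $u_i,v_i$ being distinct, with $u_i<v_i$, each $q_{u_i}$ equal to some $L_s$ and each $q_{v_i}$ equal to some $R_t$. $\mathrm{is}(\lambda/\mu)$ is the number of interval sets. -}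

module Defs where

open import Data.Nat as ℕ using (ℕ; zero; suc)
open import Data.Integer as ℤ using (ℤ; +_; -[1+_]; _≤ᵇ_)
open import Data.Bool using (Bool; true; false; _∧_; _∨_; not; if_then_else_; T)
open import Data.List using (List; []; _∷_; length; map; upTo; mapMaybe; concatMap)
open import Data.Nat.ListAction using (sum)
open import Data.Maybe using (Maybe; just; nothing)
import Data.Maybe as Maybe
open import Data.Product using (_×_; _,_; Σ)
open import Data.List.Relation.Unary.Linked using (Linked)
open import Relation.Nullary using (does)

-- Partitions: weakly decreasing lists of naturals (trailing zeros are
-- allowed and irrelevant).  `row α i` is α_i (1-indexed, 0 beyond the
-- list; `row α 0 = 0` is never used as a part).

IsPartition : List ℕ → Set
IsPartition α = Linked ℕ._≥_ α

row : List ℕ → ℕ → ℕ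
row α zero = 0
row [] (suc i) = 0
row (a ∷ α) (suc zero) = a
row (a ∷ α) (suc (suc i)) = row α (suc i)

_⊆ₚ_ : List ℕ → List ℕ → Set
mu ⊆ₚ la = (i : ℕ) → row mu i ℕ.≤ row la i

_<ᵇ_ : ℤ → ℤ → Bool
x <ᵇ y = (x ℤ.+ + 1) ≤ᵇ y

_==_ : ℤ → ℤ → Bool
x == y = does (x ℤ.≟ y)

b2n : Bool → ℕ
b2n true = 1
b2n false = 0

inSkew : List ℕ → List ℕ → ℕ → ℤ → Bool
inSkew la mu zero j = false
inSkew la mu (suc i) j = ((+ row mu (suc i)) <ᵇ j) ∧ (j ≤ᵇ (+ row la (suc i)))

-- Boundary path of a partition α.  A lattice point (x , -i) (i ≥ 0) lies
-- on the path iff x ≥ 0, α_{i+1} ≤ x and (i = 0 or x ≤ α_i).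
-- The step with index k starts at the unique path point with x + y = k.

onPath : List ℕ → ℕ → ℤ → Bool
onPath α zero x = ((+ 0) ≤ᵇ x) ∧ ((+ row α 1) ≤ᵇ x)
onPath α (suc i) x = ((+ 0) ≤ᵇ x) ∧ (x ≤ᵇ (+ row α (suc i))) ∧ ((+ row α (suc (suc i))) ≤ᵇ x)

-- search for the height i (point (k+i , -i)) of the path point of index k
search : List ℕ → ℤ → ℕ → ℕ → ℕ
search α k i zero = i
search α k i (suc f) = if onPath α i (k ℤ.+ + i) then i else search α k (suc i) f

height : List ℕ → ℤ → ℕ
height α k = search α k 0 (suc (length α ℕ.+ ℤ.∣ k ∣))

-- a unit step: horizontal/vertical, starting at (x , -i)
data Step : Set where
  hor : ℤ → ℕ → Step
  ver : ℤ → ℕ → Step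

sameStep : Step → Step → Bool
sameStep (hor x i) (hor y j) = (x == y) ∧ ((+ i) == (+ j))
sameStep (ver x i) (ver y j) = (x == y) ∧ ((+ i) == (+ j))
sameStep _ _ = false

isUp : List ℕ → ℕ → ℤ → Bool
isUp α zero x = false
isUp α (suc i) x = x == (+ row α (suc i))

step : List ℕ → ℤ → Step
step α k = if isUp α (height α k) (k ℤ.+ + height α k)
           then ver (k ℤ.+ + height α k) (height α k)
           else hor (k ℤ.+ + height α k) (height α k)

-- Sizes |S_k|.
-- horizontal e_k = lower edge of (i,j):
--   S = λ/μ ∩ {(i,j),(i,j-1),(i-1,j-1),(i-1,j-2),...}
hSize : List ℕ → List ℕ → ℕ → ℤ → ℕ
hSize la mu zero j = 0
hSize la mu (suc i) j =
  b2n (inSkew la mu (suc i) j) ℕ.+ b2n (inSkew la mu (suc i) (j ℤ.- + 1))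
  ℕ.+ hSize la mu i (j ℤ.- + 1)

-- vertical e_k = right edge of (i,j):
--   S = λ/μ ∩ {(i,j),(i-1,j),(i-1,j-1),(i-2,j-1),...}
vSize : List ℕ → List ℕ → ℕ → ℤ → ℕ
vSize la mu zero j = 0
vSize la mu (suc i) j =
  b2n (inSkew la mu (suc i) j) ℕ.+ b2n (inSkew la mu i j)
  ℕ.+ vSize la mu i (j ℤ.- + 1)

-- halfOdd n = just m  iff  n = 2m+1  (i.e. length n-1 = 2m even, n ≥ 1)
halfOdd : ℕ → Maybe ℕ
halfOdd zero = nothing
halfOdd (suc zero) = just 0
halfOdd (suc (suc n)) = Maybe.map suc (halfOdd n)

data SnakeType : Set where
  L : ℕ → SnakeType
  R : ℕ → SnakeType
  O : SnakeType

asL : Maybe ℕ → SnakeType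
asL (just m) = L m
asL nothing = O

asR : Maybe ℕ → SnakeType
asR (just m) = R m
asR nothing = O

snakeOfStep : List ℕ → List ℕ → Step → SnakeType
snakeOfStep la mu (hor x i) = asL (halfOdd (hSize la mu i (x ℤ.+ + 1)))
snakeOfStep la mu (ver x i) = asR (halfOdd (vSize la mu i x))

q : List ℕ → List ℕ → ℤ → SnakeType
q la mu k = if sameStep (step la k) (step mu k) then O else snakeOfStep la mu (step la k)

isL : SnakeType → Bool
isL (L _) = true
isL _ = false

isR : SnakeType → Bool
isR (R _) = true
isR _ = false

rowsOf : List ℕ → List ℕ
rowsOf la = map suc (upTo (length la))

colsOf : List ℕ → List ℤ
colsOf la = map (λ c → + suc c) (upTo (row la 1))

cellsOf : List ℕ → List (ℕ × ℤ)
cellsOf la = concatMap (λ i → map (λ j → (i , j)) (colsOf la)) (rowsOf la)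

outsideTop : List ℕ → List ℕ → ℕ → ℤ → Bool
outsideTop la mu i j =
  inSkew la mu i j ∧ not (inSkew la mu (ℕ.pred i) j) ∧ not (inSkew la mu i (j ℤ.- + 1))

insideTop : List ℕ → List ℕ → ℕ → ℤ → Bool
insideTop la mu i j =
  inSkew la mu i j ∧ inSkew la mu (ℕ.pred i) j ∧ inSkew la mu i (j ℤ.- + 1)
  ∧ not (inSkew la mu (ℕ.pred i) (j ℤ.- + 1))

diagN : List ℕ → List ℕ → ℕ → ℕ → ℤ → ℕ
diagN la mu zero i j = 0
diagN la mu (suc n) i j = b2n (inSkew la mu i j) ℕ.+ diagN la mu n (suc i) (j ℤ.+ + 1)

diagSize : List ℕ → List ℕ → ℕ → ℤ → ℕ
diagSize la mu i j = diagN la mu (suc (length la)) i j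

cornerSum : (List ℕ → List ℕ → ℕ → ℤ → Bool) → List ℕ → List ℕ → ℕ
cornerSum P la mu =
  sum (map (λ { (i , j) → if P la mu i j then diagSize la mu i j else 0 }) (cellsOf la))

rank : List ℕ → List ℕ → ℤ
rank la mu = (+ cornerSum outsideTop la mu) ℤ.- (+ cornerSum insideTop la mu)

-- Interval sets.  A set {(u_1,v_1),...,(u_r,v_r)} (the u_i are distinct)
-- is represented canonically by the list of its pairs sorted by u
-- strictly increasingly.

allDistinct : List ℤ → Bool
allDistinct [] = true
allDistinct (x ∷ xs) = notIn x xs ∧ allDistinct xs
  where
  notIn : ℤ → List ℤ → Bool
  notIn x [] = true
  notIn x (y ∷ ys) = not (x == y) ∧ notIn x ys

sortedU : List (ℤ × ℤ) → Bool
sortedU [] = true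
sortedU ((u , v) ∷ []) = true
sortedU ((u , v) ∷ (u' , v') ∷ ps) = (u <ᵇ u') ∧ sortedU ((u' , v') ∷ ps)

pairsOK : List ℕ → List ℕ → List (ℤ × ℤ) → Bool
pairsOK la mu [] = true
pairsOK la mu ((u , v) ∷ ps) =
  (u <ᵇ v) ∧ isL (q la mu u) ∧ isR (q la mu v) ∧ pairsOK la mu ps

isIntervalSet : List ℕ → List ℕ → List (ℤ × ℤ) → Bool
isIntervalSet la mu ps =
  ((+ length ps) == rank la mu)
  ∧ sortedU ps
  ∧ allDistinct (concatMap (λ { (u , v) → u ∷ v ∷ [] }) ps)
  ∧ pairsOK la mu ps

IntervalSet : List ℕ → List ℕ → Set
IntervalSet la mu = Σ (List (ℤ × ℤ)) (λ ps → T (isIntervalSet la mu ps))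

-- Snakes.  Outside the index range [-ℓ(λ), λ_1 - 1] every step of λ is
-- also a step of μ, so q_k = O there; we list q_k over that range.

indexRange : List ℕ → List ℤ
indexRange la = map (λ t → (ℤ.- (+ length la)) ℤ.+ (+ t)) (upTo (length la ℕ.+ row la 1))

leftHalf : SnakeType → Maybe ℕ
leftHalf (L m) = just m
leftHalf _ = nothing

rightHalf : SnakeType → Maybe ℕ
rightHalf (R m) = just m
rightHalf _ = nothing

leftSnakeHalfLengths : List ℕ → List ℕ → List ℕ
leftSnakeHalfLengths la mu = mapMaybe (λ k → leftHalf (q la mu k)) (indexRange la)

rightSnakeHalfLengths : List ℕ → List ℕ → List ℕ
rightSnakeHalfLengths la mu = mapMaybe (λ k → rightHalf (q la mu k)) (indexRange la)

{-# OPTIONS --safe #-}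
-- For k ∈ ℤ let D k be the number of cells of content k in λ/μ.  It is the
-- height difference of the boundary paths of λ and μ at index k, it vanishes for
-- |k| large, and |S_k| = D k + D (k + 1).  Hence q_k = L_m exactly when D climbs
-- from m to m + 1 at k, q_k = R_m exactly when D descends from m + 1 to m, and
-- D is constant at k otherwise.
--
-- Each diagonal of λ/μ starts in an outside corner, in an inside corner or in
-- neither according to the two steps of μ around it, so that summation by parts
-- along the contents turns the rank into the number of climbs of D.  An interval
-- set is therefore a perfect matching of the left with the right snakes.
--
-- Matching the left snakes from right to left, the one at k has a choice among
-- the D (k + 1) = m + 1 right snakes beyond it that are still free.  The products
-- over left and over right snakes agree because D climbs through each level as
-- often as it descends through it.
module Submission where

open import Defs
open import Data.Nat using (ℕ; zero; suc; _+_; _*_; _∸_; _≤_; _<_; _≤?_; z≤n; s≤s; s≤s⁻¹; ≤′-refl; ≤′-step; _!)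
open import Data.Nat.ListAction using (sum; product)
open import Data.Nat.ListAction.Properties using (sum-++)
open import Data.Nat.Tactic.RingSolver using (solve-∀)
import Data.Nat.Properties as ℕ
open import Data.Integer as ℤ using (ℤ; +_; -[1+_]; +≤+)
import Data.Integer.Properties as ℤ
import Data.Integer.Tactic.RingSolver as ℤ-Solver
open import Data.Bool using (Bool; true; false; T; _∧_; not; if_then_else_)
open import Data.Bool.Properties using (T-≡; T-irrelevant; ∧-zeroʳ; ∧-identityʳ; not-involutive)
open import Data.List using (List; []; _∷_; _++_; length; map; upTo; applyUpTo; mapMaybe; concatMap)
open import Data.List.Properties using (map-++; map-∘; map-upTo)
open import Data.List.Relation.Unary.Linked using ([]; [-]; _∷_)
open import Data.Maybe using (Maybe; just; nothing)
open import Data.Fin using (Fin; zero; suc)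
open import Data.Fin.Properties using (*↔×; ¬Fin0)
open import Data.Product using (Σ; ∃; _×_; _,_; proj₁; proj₂)
open import Data.Sum using (_⊎_; inj₁; inj₂)
open import Function using (_∘_; id)
open import Function.Bundles using (_↔_; mk↔ₛ′; Equivalence; Inverse)
open import Relation.Nullary using (¬_; yes; no; contradiction)
open import Relation.Nullary.Decidable using (dec-true; dec-false)
open import Relation.Binary.Definitions using (tri<; tri≈; tri>)
open import Relation.Binary.PropositionalEquality

private
  variable
    α : List ℕ
    i j k : ℤ

-- Integer order, shifts and Boolean conjunctions

<⇒+1≤ : i ℤ.< j → i ℤ.+ + 1 ℤ.≤ j
<⇒+1≤ {i} i<j = subst (ℤ._≤ _) (ℤ.+-comm (+ 1) i) (ℤ.i<j⇒suc[i]≤j i<j)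

+1≤⇒< : i ℤ.+ + 1 ℤ.≤ j → i ℤ.< j
+1≤⇒< {i} i+1≤j = ℤ.suc[i]≤j⇒i<j (subst (ℤ._≤ _) (ℤ.+-comm i (+ 1)) i+1≤j)

≰⇒+1≤ : ¬ i ℤ.≤ j → j ℤ.+ + 1 ℤ.≤ i
≰⇒+1≤ i≰j = <⇒+1≤ (ℤ.≰⇒> i≰j)

+-suc-shift : ∀ k n → k ℤ.+ + suc n ≡ k ℤ.+ + 1 ℤ.+ + n
+-suc-shift k n = sym (ℤ.+-assoc k (+ 1) (+ n))

+-suc-last : ∀ k n → k ℤ.+ + suc n ≡ k ℤ.+ + n ℤ.+ + 1
+-suc-last k n = trans (cong (λ z → k ℤ.+ z) (ℤ.+-comm (+ 1) (+ n))) (sym (ℤ.+-assoc k (+ n) (+ 1)))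

+1-1 : ∀ k → k ℤ.+ + 1 ℤ.- + 1 ≡ k
+1-1 k = trans (ℤ.+-assoc k (+ 1) (ℤ.- (+ 1))) (ℤ.+-identityʳ k)

+-suc-1 : ∀ k n → k ℤ.+ + suc n ℤ.- + 1 ≡ k ℤ.+ + n
+-suc-1 k n = trans (cong (ℤ._- + 1) (+-suc-last k n)) (+1-1 (k ℤ.+ + n))

i≤i+1 : ∀ i → i ℤ.≤ i ℤ.+ + 1
i≤i+1 i = ℤ.i≤i+j i (+ 1)

+-interchange : ∀ a b c d → a + b + (c + d) ≡ (a + c) + (b + d)
+-interchange = solve-∀

T⇒≡true : ∀ {b} → T b → b ≡ true
T⇒≡true = Equivalence.to T-≡

≡true⇒T : ∀ {b} → b ≡ true → T b
≡true⇒T = Equivalence.from T-≡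

¬T⇒≡false : ∀ {b} → ¬ T b → b ≡ false
¬T⇒≡false {true}  ¬t = contradiction _ ¬t
¬T⇒≡false {false} ¬t = refl

∧-fst : ∀ a {b} → T (a ∧ b) → T a
∧-fst true _ = _

∧-snd : ∀ a {b} → T (a ∧ b) → T b
∧-snd true t = t

∧-intro : ∀ {a b} → T a → T b → T (a ∧ b)
∧-intro {true} _ t = t

-- Heights of boundary paths

row-antitone-step : ∀ α → IsPartition α → ∀ n → row α (suc (suc n)) ≤ row α (suc n)
row-antitone-step []          _       n       = z≤n
row-antitone-step (a ∷ [])    _       zero    = z≤n
row-antitone-step (a ∷ [])    _       (suc n) = z≤n
row-antitone-step (a ∷ b ∷ α) (r ∷ p) zero    = r
row-antitone-step (a ∷ b ∷ α) (r ∷ p) (suc n) = row-antitone-step (b ∷ α) p n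

row-antitone : IsPartition α → ∀ {m n} → m ≤ n → row α (suc n) ≤ row α (suc m)
row-antitone p {m} {n} m≤n with ℕ.≤⇒≤′ m≤n
... | ≤′-refl = ℕ.≤-refl
... | ≤′-step m≤′n =
  ℕ.≤-trans (row-antitone-step _ p _) (row-antitone p (ℕ.≤′⇒≤ m≤′n))

row-beyond : ∀ α n → length α ≤ n → row α (suc n) ≡ 0
row-beyond []      n       _         = refl
row-beyond (a ∷ α) (suc n) (s≤s α≤n) = row-beyond α n α≤n

-- The point `(k + h , -h)` lies on the boundary path. `lower` asks for a predecessor of `h` because
-- at height 0 there is no row above the point to bound it.
record IsHeight (α : List ℕ) (k : ℤ) (h : ℕ) : Set where
  field
    lower : ∀ n → h ≡ suc n → k ℤ.+ + suc n ℤ.≤ + row α (suc n)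
    upper : + row α (suc h) ℤ.≤ k ℤ.+ + h

open IsHeight

onPath⇒row≤ : ∀ α n {x} → T (onPath α n x) → + row α (suc n) ℤ.≤ x
onPath⇒row≤ α zero    {x} t = ℤ.≤ᵇ⇒≤ (∧-snd (+ 0 ℤ.≤ᵇ x) t)
onPath⇒row≤ α (suc n) {x} t =
  ℤ.≤ᵇ⇒≤ (∧-snd (x ℤ.≤ᵇ + row α (suc n)) (∧-snd (+ 0 ℤ.≤ᵇ x) t))

onPath-intro : ∀ α n {x} → (∀ m → n ≡ suc m → x ℤ.≤ + row α (suc m)) →
               + row α (suc n) ℤ.≤ x → T (onPath α n x)
onPath-intro α zero    lo up =
  ∧-intro (ℤ.≤⇒≤ᵇ (ℤ.≤-trans (+≤+ z≤n) up)) (ℤ.≤⇒≤ᵇ up)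
onPath-intro α (suc n) lo up =
  ∧-intro (ℤ.≤⇒≤ᵇ (ℤ.≤-trans (+≤+ z≤n) up)) (∧-intro (ℤ.≤⇒≤ᵇ (lo n refl)) (ℤ.≤⇒≤ᵇ up))

0≤k+∣k∣ : ∀ k → + 0 ℤ.≤ k ℤ.+ + ℤ.∣ k ∣
0≤k+∣k∣ (+ n)    = +≤+ z≤n
0≤k+∣k∣ -[1+ n ] = ℤ.≤-reflexive (sym (ℤ.n⊖n≡0 (suc n)))

-- A failed test at `n` gives `k + n < row α (n + 1)`, which is the invariant `lo` at `n + 1`. The
-- fuel suffices: at a height `m + 1` above `length α + ∣ k ∣` the row is 0, so `lo` would force
-- `k + m < 0`, against `k + ∣ k ∣ ≥ 0`.
search-isHeight : ∀ α k n f → (∀ m → n ≡ suc m → k ℤ.+ + suc m ℤ.≤ + row α (suc m)) →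
                  length α + ℤ.∣ k ∣ < n + f → IsHeight α k (search α k n f)
search-isHeight α k zero zero lo ()
search-isHeight α k (suc m) zero lo fuel = contradiction k+m<0 (ℤ.≤⇒≯ 0≤k+m)
  where
  bound : length α + ℤ.∣ k ∣ ≤ m
  bound = subst (length α + ℤ.∣ k ∣ ≤_) (ℕ.+-identityʳ m) (s≤s⁻¹ fuel)
  k+m<0 : k ℤ.+ + m ℤ.< + 0
  k+m<0 = +1≤⇒< (subst₂ ℤ._≤_ (+-suc-last k m)
    (cong +_ (row-beyond α m (ℕ.m+n≤o⇒m≤o _ bound))) (lo m refl))
  0≤k+m : + 0 ℤ.≤ k ℤ.+ + m
  0≤k+m = ℤ.≤-trans (0≤k+∣k∣ k) (ℤ.+-monoʳ-≤ k (+≤+ (ℕ.m+n≤o⇒n≤o (length α) bound)))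
search-isHeight α k n (suc f) lo fuel with + row α (suc n) ℤ.≤? k ℤ.+ + n
... | yes up rewrite T⇒≡true (onPath-intro α n (λ { m refl → lo m refl }) up) =
  record { lower = lo ; upper = up }
... | no ¬up rewrite ¬T⇒≡false (¬up ∘ onPath⇒row≤ α n) =
  search-isHeight α k (suc n) f
    (λ { m refl → subst (ℤ._≤ _) (sym (+-suc-last k n)) (≰⇒+1≤ ¬up) })
    (subst (length α + ℤ.∣ k ∣ <_) (ℕ.+-suc n f) fuel)

height-isHeight : ∀ α k → IsHeight α k (height α k)
height-isHeight α k = search-isHeight α k 0 _ (λ _ ()) ℕ.≤-refl

rising : List ℕ → ℤ → Bool
rising α k = isUp α (height α k) (k ℤ.+ + height α k)

-- Heights are measured downwards from `y = 0`, so a step that goes up lowers `height` by one.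
data StepView (α : List ℕ) (k : ℤ) : Set where
  vertical   : rising α k ≡ true  → height α k ≡ suc (height α (k ℤ.+ + 1)) → StepView α k
  horizontal : rising α k ≡ false → height α k ≡ height α (k ℤ.+ + 1) → StepView α k

module _ (part : IsPartition α) where

  -- Down a diagonal the columns grow while the rows shrink, so the positions `(n , k + n)` not
  -- beyond the end of their row form an initial segment, and `height α k` is its length. This and
  -- the converse below replace the search in all later arguments.
  fits⇒≤height : ∀ k n → k ℤ.+ + suc n ℤ.≤ + row α (suc n) → suc n ≤ height α k
  fits⇒≤height k n fit with suc n ≤? height α k
  ... | yes n<h = n<h
  ... | no  n≮h = contradiction
    (ℤ.≤-trans fit (ℤ.≤-trans (+≤+ (row-antitone part h≤n))
      (ℤ.≤-trans (upper (height-isHeight α k)) (ℤ.+-monoʳ-≤ k (+≤+ h≤n)))))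
    (ℤ.<⇒≱ (+1≤⇒< (ℤ.≤-reflexive (sym (+-suc-last k n)))))
    where
    h≤n : height α k ≤ n
    h≤n = s≤s⁻¹ (ℕ.≰⇒> n≮h)

  ≤height⇒fits : ∀ k n → suc n ≤ height α k → k ℤ.+ + suc n ℤ.≤ + row α (suc n)
  ≤height⇒fits k n n<h with height α k | height-isHeight α k
  ... | suc h | isH = ℤ.≤-trans (ℤ.+-monoʳ-≤ k (+≤+ n<h))
    (ℤ.≤-trans (lower isH h refl) (+≤+ (row-antitone part (s≤s⁻¹ n<h))))

  height-next≤ : ∀ k → height α (k ℤ.+ + 1) ≤ height α k
  height-next≤ k with height α (k ℤ.+ + 1) in eq
  ... | zero  = z≤n
  ... | suc n = fits⇒≤height k n (ℤ.≤-trans (ℤ.+-monoˡ-≤ (+ suc n) (i≤i+1 k))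
    (≤height⇒fits (k ℤ.+ + 1) n (ℕ.≤-reflexive (sym eq))))

  -- The position of content `k` in row `n + 2` lies directly below the one of content `k + 1` in
  -- row `n + 1`.
  height≤suc-next : ∀ k → height α k ≤ suc (height α (k ℤ.+ + 1))
  height≤suc-next k with height α k in eq
  ... | zero        = z≤n
  ... | suc zero    = s≤s z≤n
  ... | suc (suc n) = s≤s (fits⇒≤height (k ℤ.+ + 1) n
    (subst (ℤ._≤ _) (+-suc-shift k (suc n))
      (ℤ.≤-trans (≤height⇒fits k (suc n) (ℕ.≤-reflexive (sym eq))) (+≤+ (row-antitone-step α part n)))))

  private
    isUp-drops : ∀ k h → height α k ≡ h → isUp α h (k ℤ.+ + h) ≡ true →
                 height α (k ℤ.+ + 1) < h
    isUp-drops k (suc n) eq up with k ℤ.+ + suc n ℤ.≟ + row α (suc n)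
    ... | yes k+n≡row = ℕ.≰⇒> λ n<h → ℤ.<⇒≱ (+1≤⇒< ℤ.≤-refl)
      (subst₂ ℤ._≤_ (trans (sym (+-suc-shift k (suc n))) (+-suc-last k (suc n))) (sym k+n≡row)
        (≤height⇒fits (k ℤ.+ + 1) n n<h))

    ¬isUp-stays : ∀ k h → height α k ≡ h → isUp α h (k ℤ.+ + h) ≡ false →
                  h ≤ height α (k ℤ.+ + 1)
    ¬isUp-stays k zero    eq up = z≤n
    ¬isUp-stays k (suc n) eq up with k ℤ.+ + suc n ℤ.≟ + row α (suc n)
    ... | no k+n≢row = fits⇒≤height (k ℤ.+ + 1) n
      (subst (ℤ._≤ _) (trans (sym (+-suc-last k (suc n))) (+-suc-shift k (suc n)))
        (<⇒+1≤ (ℤ.≤∧≢⇒< (≤height⇒fits k n (ℕ.≤-reflexive (sym eq))) k+n≢row)))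

  stepView : ∀ k → StepView α k
  stepView k with rising α k in eq
  ... | true  = vertical eq
    (ℕ.≤-antisym (height≤suc-next k) (isUp-drops k _ refl eq))
  ... | false = horizontal eq
    (ℕ.≤-antisym (¬isUp-stays k _ refl eq) (height-next≤ k))

-- Enumerations of the elements satisfying a predicate

-- Exactly `n` elements satisfy `P`, with no comparison of the proofs of `P`. Hence `P` can be
-- exchanged for any equivalent predicate, and a bijection with `Fin n` is formed only at the end,
-- for a Boolean test whose proofs are unique.
record Enumeration {A : Set} (n : ℕ) (P : A → Set) : Set where
  field
    enum      : Fin n → A
    injective : ∀ {i j} → enum i ≡ enum j → i ≡ j
    sound     : ∀ i → P (enum i)
    complete  : ∀ {x} → P x → ∃ λ i → enum i ≡ x

open Enumeration

module _ {A : Set} where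

  enum-⇔ : ∀ {n} {P Q : A → Set} → (∀ {x} → P x → Q x) → (∀ {x} → Q x → P x) →
           Enumeration n P → Enumeration n Q
  enum-⇔ P⇒Q Q⇒P E = record
    { enum      = enum E
    ; injective = injective E
    ; sound     = P⇒Q ∘ sound E
    ; complete  = complete E ∘ Q⇒P
    }

  enum-∅ : {P : A → Set} → (∀ {x} → ¬ P x) → Enumeration 0 P
  enum-∅ ¬P = record
    { enum      = λ ()
    ; injective = λ {i} _ → contradiction i ¬Fin0
    ; sound     = λ ()
    ; complete  = λ Px → contradiction Px ¬P
    }

  enum-singleton : (a : A) → Enumeration 1 (_≡ a)
  enum-singleton a = record
    { enum      = λ _ → a
    ; injective = λ { {zero} {zero} _ → refl }
    ; sound     = λ _ → refl
    ; complete  = λ x≡a → zero , sym x≡a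
    }

  enum-insert : ∀ {n} {P : A → Set} a → ¬ P a → Enumeration n P →
                Enumeration (suc n) (λ x → x ≡ a ⊎ P x)
  enum-insert {n} {P} a ¬Pa E = record
    { enum      = f
    ; injective = f-injective
    ; sound     = λ { zero → inj₁ refl ; (suc i) → inj₂ (sound E i) }
    ; complete  = λ { (inj₁ x≡a) → zero , sym x≡a
                    ; (inj₂ Px)  → suc (proj₁ (complete E Px)) , proj₂ (complete E Px) }
    }
    where
    f : Fin (suc n) → A
    f zero    = a
    f (suc i) = enum E i
    f-injective : ∀ {i j} → f i ≡ f j → i ≡ j
    f-injective {zero}  {zero}  _  = refl
    f-injective {zero}  {suc j} eq = contradiction (subst P (sym eq) (sound E j)) ¬Pa
    f-injective {suc i} {zero}  eq = contradiction (subst P eq (sound E i)) ¬Pa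
    f-injective {suc i} {suc j} eq = cong suc (injective E eq)

  enum-map : ∀ {B : Set} {n} {P : A → Set} (f : A → B) → (∀ {x y} → f x ≡ f y → x ≡ y) →
             Enumeration n P → Enumeration n (λ y → ∃ λ x → P x × f x ≡ y)
  enum-map f f-inj E = record
    { enum      = f ∘ enum E
    ; injective = injective E ∘ f-inj
    ; sound     = λ i → enum E i , sound E i , refl
    ; complete  = λ { (x , Px , refl) →
        proj₁ (complete E Px) , cong f (proj₂ (complete E Px)) }
    }

  -- The fibres may vary with `x` as long as they all have size `m`: the partners available to a
  -- left snake depend on the pairs already chosen, but their number does not.
  enum-Σ : ∀ {B : Set} {m n} {P : A → Set} {Q : A → B → Set} →
           Enumeration n P → (∀ {x} → P x → Enumeration m (Q x)) →
           Enumeration (m * n) (λ ((y , x) : B × A) → P x × Q x y)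
  enum-Σ {B} {m} {n} {P} {Q} E F = record
    { enum      = f ∘ split
    ; injective = λ eq → split-injective (f-injective eq)
    ; sound     = λ i → sound E (proj₂ (split i)) , sound (F _) (proj₁ (split i))
    ; complete  = λ { (Px , Qxy) → f-complete Px Qxy }
    }
    where
    open Inverse (*↔× {m} {n}) using (strictlyInverseˡ; strictlyInverseʳ) renaming (to to split; from to join)
    split-injective : ∀ {i j} → split i ≡ split j → i ≡ j
    split-injective {i} {j} eq =
      trans (sym (strictlyInverseʳ i)) (trans (cong join eq) (strictlyInverseʳ j))
    f : Fin m × Fin n → B × A
    f (j , i) = enum (F (sound E i)) j , enum E i
    f-injective : ∀ {p p′} → f p ≡ f p′ → p ≡ p′
    f-injective {j , i} {j′ , i′} eq with injective E (cong proj₂ eq)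
    ... | refl = cong (_, i) (injective (F (sound E i)) (cong proj₁ eq))
    f-complete : ∀ {x y} → P x → Q x y → ∃ λ i → f (split i) ≡ (y , x)
    f-complete Px Qxy with complete E Px
    -- The index of `y` is looked up in the enumeration built from `sound E i`, the one that `f`
    -- uses, and not in the one built from the given proof of `P x`.
    ... | i , refl with complete (F (sound E i)) Qxy
    ... | j , refl = join (j , i) , cong f (strictlyInverseˡ (j , i))

  enum⇒↔ : ∀ {n} (p : A → Bool) → Enumeration n (T ∘ p) → Σ A (T ∘ p) ↔ Fin n
  enum⇒↔ p E = mk↔ₛ′ (λ (_ , t) → proj₁ (complete E t)) (λ i → enum E i , sound E i)
    (λ i → injective E (proj₂ (complete E (sound E i))))
    (λ (x , t) → pair-≡ (proj₂ (complete E t)))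
    where
    pair-≡ : ∀ {x y t u} → x ≡ y → (x , t) ≡ (y , u)
    pair-≡ refl = cong (_ ,_) (T-irrelevant _ _)

-- Counting in integer intervals

≤-split : ∀ {k v} → k ℤ.≤ v → v ≡ k ⊎ k ℤ.+ + 1 ℤ.≤ v
≤-split {k} {v} k≤v with v ℤ.≟ k
... | yes v≡k = inj₁ v≡k
... | no  v≢k = inj₂ (<⇒+1≤ (ℤ.≤∧≢⇒< k≤v (v≢k ∘ sym)))

+1≰ : ¬ k ℤ.+ + 1 ℤ.≤ k
+1≰ k+1≤k = ℤ.<⇒≱ (+1≤⇒< k+1≤k) ℤ.≤-refl

range : ℤ → ℕ → List ℤ
range k zero    = []
range k (suc n) = k ∷ range (k ℤ.+ + 1) n

map-upTo≡range : ∀ k n → map (λ t → k ℤ.+ + t) (upTo n) ≡ range k n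
map-upTo≡range k n = trans (map-upTo (λ t → k ℤ.+ + t) n) (go k n (λ t → refl))
  where
  go : ∀ k n {f : ℕ → ℤ} → (∀ t → f t ≡ k ℤ.+ + t) → applyUpTo f n ≡ range k n
  go k zero    f≗ = refl
  go k (suc n) f≗ = cong₂ _∷_ (trans (f≗ 0) (ℤ.+-identityʳ k))
    (go (k ℤ.+ + 1) n (λ t → trans (f≗ (suc t)) (+-suc-shift k t)))

count : (ℤ → Bool) → ℤ → ℕ → ℕ
count p k zero    = 0
count p k (suc n) = b2n (p k) + count p (k ℤ.+ + 1) n

count-head : ∀ p k n {b} → p k ≡ b → count p k (suc n) ≡ b2n b + count p (k ℤ.+ + 1) n
count-head p k n refl = refl

enum-range : ∀ p k n → Enumeration (count p k n) (λ v → k ℤ.≤ v × v ℤ.< k ℤ.+ + n × T (p v))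
enum-range p k zero = enum-∅ λ { (k≤v , v<k , _) →
  ℤ.<⇒≱ v<k (subst (ℤ._≤ _) (sym (ℤ.+-identityʳ k)) k≤v) }
enum-range p k (suc n) with p k in eq
... | false = enum-⇔
  (λ { (k<v , v<e , pv) → ℤ.≤-trans (i≤i+1 k) k<v , subst (_ ℤ.<_) (sym (+-suc-shift k n)) v<e , pv })
  (λ { (k≤v , v<e , pv) → tail k≤v pv , subst (_ ℤ.<_) (+-suc-shift k n) v<e , pv })
  (enum-range p (k ℤ.+ + 1) n)
  where
  tail : ∀ {v} → k ℤ.≤ v → T (p v) → k ℤ.+ + 1 ℤ.≤ v
  tail k≤v pv with ≤-split k≤v
  ... | inj₁ refl = contradiction (subst T eq pv) id
  ... | inj₂ k<v  = k<v
... | true = enum-⇔ to from (enum-insert k (+1≰ ∘ proj₁) (enum-range p (k ℤ.+ + 1) n))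
  where
  to : ∀ {v} → v ≡ k ⊎ (k ℤ.+ + 1 ℤ.≤ v × v ℤ.< k ℤ.+ + 1 ℤ.+ + n × T (p v)) →
       k ℤ.≤ v × v ℤ.< k ℤ.+ + suc n × T (p v)
  to (inj₁ refl) = ℤ.≤-refl
    , +1≤⇒< (ℤ.+-monoʳ-≤ k (+≤+ (s≤s z≤n))) , ≡true⇒T eq
  to (inj₂ (k<v , v<e , pv)) =
    ℤ.≤-trans (i≤i+1 k) k<v , subst (_ ℤ.<_) (sym (+-suc-shift k n)) v<e , pv
  from : ∀ {v} → k ℤ.≤ v × v ℤ.< k ℤ.+ + suc n × T (p v) →
         v ≡ k ⊎ (k ℤ.+ + 1 ℤ.≤ v × v ℤ.< k ℤ.+ + 1 ℤ.+ + n × T (p v))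
  from (k≤v , v<e , pv) with ≤-split k≤v
  ... | inj₁ v≡k = inj₁ v≡k
  ... | inj₂ k<v = inj₂ (k<v , subst (_ ℤ.<_) (+-suc-shift k n) v<e , pv)

count-cong : ∀ {p p′} k n → (∀ v → k ℤ.≤ v → p v ≡ p′ v) → count p k n ≡ count p′ k n
count-cong k zero    p≗p′ = refl
count-cong k (suc n) p≗p′ = cong₂ _+_ (cong b2n (p≗p′ k ℤ.≤-refl))
  (count-cong (k ℤ.+ + 1) n (λ v k<v → p≗p′ v (ℤ.≤-trans (i≤i+1 k) k<v)))

count-remove : ∀ {p p′} w k n → (∀ v → v ≢ w → p′ v ≡ p v) → p′ w ≡ false → p w ≡ true →
               k ℤ.≤ w → w ℤ.< k ℤ.+ + n → suc (count p′ k n) ≡ count p k n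
count-remove w k zero agree p′w pw k≤w w<k =
  contradiction (subst (ℤ._≤ _) (sym (ℤ.+-identityʳ k)) k≤w) (ℤ.<⇒≱ w<k)
count-remove {p} {p′} w k (suc n) agree p′w pw k≤w w<e with ≤-split k≤w
... | inj₁ refl rewrite p′w | pw = cong suc
  (count-cong (k ℤ.+ + 1) n (λ v k<v → agree v (λ { refl → +1≰ k<v })))
... | inj₂ k<w = begin
  suc (b2n (p′ k) + count p′ (k ℤ.+ + 1) n)
    ≡⟨ sym (ℕ.+-suc (b2n (p′ k)) _) ⟩
  b2n (p′ k) + suc (count p′ (k ℤ.+ + 1) n)
    ≡⟨ cong₂ _+_ (cong b2n (agree k λ { refl → +1≰ k<w }))
         (count-remove w (k ℤ.+ + 1) n agree p′w pw k<w (subst (w ℤ.<_) (+-suc-shift k n) w<e)) ⟩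
  b2n (p k) + count p (k ℤ.+ + 1) n ∎
  where open ≡-Reasoning

mapMaybe-just : ∀ {A B : Set} (f : A → Maybe B) {x y} xs → f x ≡ just y →
                mapMaybe f (x ∷ xs) ≡ y ∷ mapMaybe f xs
mapMaybe-just f xs eq rewrite eq = refl

mapMaybe-nothing : ∀ {A B : Set} (f : A → Maybe B) {x} xs → f x ≡ nothing →
                   mapMaybe f (x ∷ xs) ≡ mapMaybe f xs
mapMaybe-nothing f xs eq rewrite eq = refl

-- Finite sums

∑ : ℕ → (ℕ → ℕ) → ℕ
∑ zero    f = 0
∑ (suc n) f = f 0 + ∑ n (f ∘ suc)

∑-cong : ∀ n {f g} → (∀ t → t < n → f t ≡ g t) → ∑ n f ≡ ∑ n g
∑-cong zero    f≗g = refl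
∑-cong (suc n) f≗g = cong₂ _+_ (f≗g 0 (s≤s z≤n)) (∑-cong n (λ t t<n → f≗g (suc t) (s≤s t<n)))

∑-zero : ∀ n {f} → (∀ t → t < n → f t ≡ 0) → ∑ n f ≡ 0
∑-zero zero    f≗0 = refl
∑-zero (suc n) f≗0 = cong₂ _+_ (f≗0 0 (s≤s z≤n)) (∑-zero n (λ t t<n → f≗0 (suc t) (s≤s t<n)))

∑-distrib-+ : ∀ n f g → ∑ n (λ t → f t + g t) ≡ ∑ n f + ∑ n g
∑-distrib-+ zero    f g = refl
∑-distrib-+ (suc n) f g rewrite ∑-distrib-+ n (f ∘ suc) (g ∘ suc) =
  +-interchange (f 0) (g 0) (∑ n (f ∘ suc)) (∑ n (g ∘ suc))

∑-swap : ∀ m n (f : ℕ → ℕ → ℕ) → ∑ m (λ a → ∑ n (f a)) ≡ ∑ n (λ b → ∑ m (λ a → f a b))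
∑-swap zero    n f = sym (∑-zero n (λ _ _ → refl))
∑-swap (suc m) n f = trans (cong (λ z → ∑ n (f 0) + z) (∑-swap m n (f ∘ suc)))
  (sym (∑-distrib-+ n (f 0) (λ b → ∑ m (λ a → f (suc a) b))))

∑-split : ∀ m n f → ∑ (m + n) f ≡ ∑ m f + ∑ n (λ t → f (m + t))
∑-split zero    n f = refl
∑-split (suc m) n f = trans (cong (λ z → f 0 + z) (∑-split m n (f ∘ suc))) (sym (ℕ.+-assoc (f 0) _ _))

∑-single : ∀ n {f} a → a < n → (∀ t → t < n → t ≢ a → f t ≡ 0) → ∑ n f ≡ f a
∑-single (suc n) {f} zero    _ off = trans
  (cong (λ z → f 0 + z) (∑-zero n (λ t t<n → off (suc t) (s≤s t<n) (λ ())))) (ℕ.+-identityʳ (f 0))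
∑-single (suc n) {f} (suc a) (s≤s a<n) off = cong₂ _+_ (off 0 (s≤s z≤n) (λ ()))
  (∑-single n {f ∘ suc} a a<n (λ t t<n t≢a → off (suc t) (s≤s t<n) (t≢a ∘ ℕ.suc-injective)))

-- Summation of `A - B = ℓ - ΔE`, written without subtraction. Only the boundary terms `E 0` and
-- `E n` survive, and both are 0 in the application to the rank.
∑-telescope : ∀ n (A B E ℓ : ℕ → ℕ) → (∀ t → A t + E (suc t) ≡ B t + E t + ℓ t) →
              ∑ n A + E n ≡ ∑ n B + E 0 + ∑ n ℓ
∑-telescope zero    A B E ℓ step≡ = sym (ℕ.+-identityʳ (E 0))
∑-telescope (suc n) A B E ℓ step≡ = begin
  A 0 + ∑ n (A ∘ suc) + E (suc n)
    ≡⟨ ℕ.+-assoc (A 0) _ _ ⟩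
  A 0 + (∑ n (A ∘ suc) + E (suc n))
    ≡⟨ cong (λ z → A 0 + z) (∑-telescope n (A ∘ suc) (B ∘ suc) (E ∘ suc) (ℓ ∘ suc) (step≡ ∘ suc)) ⟩
  A 0 + (∑ n (B ∘ suc) + E 1 + ∑ n (ℓ ∘ suc))
    ≡⟨ pull (A 0) (∑ n (B ∘ suc)) (E 1) (∑ n (ℓ ∘ suc)) ⟩
  (A 0 + E 1) + (∑ n (B ∘ suc) + ∑ n (ℓ ∘ suc))
    ≡⟨ cong (λ z → z + (∑ n (B ∘ suc) + ∑ n (ℓ ∘ suc))) (step≡ 0) ⟩
  (B 0 + E 0 + ℓ 0) + (∑ n (B ∘ suc) + ∑ n (ℓ ∘ suc))
    ≡⟨ regroup (B 0) (E 0) (ℓ 0) (∑ n (B ∘ suc)) (∑ n (ℓ ∘ suc)) ⟩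
  B 0 + ∑ n (B ∘ suc) + E 0 + (ℓ 0 + ∑ n (ℓ ∘ suc)) ∎
  where
  open ≡-Reasoning
  pull : ∀ a b e l → a + (b + e + l) ≡ (a + e) + (b + l)
  pull = solve-∀
  regroup : ∀ b e l b′ l′ → (b + e + l) + (b′ + l′) ≡ b + b′ + e + (l + l′)
  regroup = solve-∀

count≡∑ : ∀ p k n → count p k n ≡ ∑ n (λ t → b2n (p (k ℤ.+ + t)))
count≡∑ p k zero    = refl
count≡∑ p k (suc n) = cong₂ _+_ (cong (b2n ∘ p) (sym (ℤ.+-identityʳ k)))
  (trans (count≡∑ p (k ℤ.+ + 1) n) (∑-cong n (λ t _ → cong (b2n ∘ p) (sym (+-suc-shift k t)))))

sum-map-upTo : ∀ {A : Set} (f : A → ℕ) (g : ℕ → A) n → sum (map f (map g (upTo n))) ≡ ∑ n (f ∘ g)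
sum-map-upTo {A} f g n = go n id
  where
  go : ∀ n (h : ℕ → ℕ) → sum (map f (map g (applyUpTo h n))) ≡ ∑ n (f ∘ g ∘ h)
  go zero    h = refl
  go (suc n) h = cong (λ z → f (g (h 0)) + z) (go n (h ∘ suc))

sum-map-concatMap : ∀ {A B : Set} (f : B → ℕ) (g : A → List B) xs →
                    sum (map f (concatMap g xs)) ≡ sum (map (λ x → sum (map f (g x))) xs)
sum-map-concatMap f g []       = refl
sum-map-concatMap f g (x ∷ xs) = begin
  sum (map f (g x ++ concatMap g xs))
    ≡⟨ cong sum (map-++ f (g x) (concatMap g xs)) ⟩
  sum (map f (g x) ++ map f (concatMap g xs))
    ≡⟨ sum-++ (map f (g x)) _ ⟩
  sum (map f (g x)) + sum (map f (concatMap g xs))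
    ≡⟨ cong (λ z → sum (map f (g x)) + z) (sum-map-concatMap f g xs) ⟩
  sum (map f (g x)) + sum (map (λ x → sum (map f (g x))) xs) ∎
  where open ≡-Reasoning

sum-cells : ∀ la (f : ℕ × ℤ → ℕ) → sum (map f (cellsOf la)) ≡
            ∑ (length la) (λ a → ∑ (row la 1) (λ b → f (suc a , + suc b)))
sum-cells la f = begin
  sum (map f (cellsOf la))
    ≡⟨ sum-map-concatMap f (λ i → map (i ,_) (colsOf la)) (rowsOf la) ⟩
  sum (map (λ i → sum (map f (map (i ,_) (colsOf la)))) (rowsOf la))
    ≡⟨ sum-map-upTo (λ i → sum (map f (map (i ,_) (colsOf la)))) suc (length la) ⟩
  ∑ (length la) (λ a → sum (map f (map (suc a ,_) (colsOf la))))
    ≡⟨ ∑-cong (length la) (λ a _ → trans (cong sum (sym (map-∘ (colsOf la))))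
         (sum-map-upTo (λ j → f (suc a , j)) (λ c → + suc c) (row la 1))) ⟩
  ∑ (length la) (λ a → ∑ (row la 1) (λ b → f (suc a , + suc b))) ∎
  where open ≡-Reasoning

-- Matchings of left with right snakes

-- Together with the vanishing of `D` from some index on, this is all that the counting of matchings
-- uses of a skew shape.
data Crossing (s : ℤ → SnakeType) (D : ℤ → ℕ) (k : ℤ) : Set where
  flat : s k ≡ O → D (k ℤ.+ + 1) ≡ D k → Crossing s D k
  up   : s k ≡ L (D k) → D (k ℤ.+ + 1) ≡ suc (D k) → Crossing s D k
  down : s k ≡ R (D (k ℤ.+ + 1)) → D k ≡ suc (D (k ℤ.+ + 1)) → Crossing s D k

-- Only right endpoints are compared: the type of a snake already separates `v` from the left
-- endpoints.
fresh : ℤ → List (ℤ × ℤ) → Bool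
fresh v []             = true
fresh v ((_ , w) ∷ ps) = not (v == w) ∧ fresh v ps

module Matching (s : ℤ → SnakeType) (D : ℤ → ℕ) (end : ℤ)
                (crossing : ∀ k → Crossing s D k) (D-end : ∀ k → end ℤ.≤ k → D k ≡ 0) where

  isLeft isRight : ℤ → Bool
  isLeft  = isL ∘ s
  isRight = isR ∘ s

  leftHalves rightHalves : ℤ → ℕ → List ℕ
  leftHalves  k n = mapMaybe (λ k → leftHalf (s k)) (range k n)
  rightHalves k n = mapMaybe (λ k → rightHalf (s k)) (range k n)

  private
    variable
      u v : ℤ
      ps : List (ℤ × ℤ)

  isLeft⇒D-next : ∀ k → T (isLeft k) → ∃ λ m → D (k ℤ.+ + 1) ≡ suc m
  isLeft⇒D-next k l with crossing k
  ... | flat sk _  = contradiction (subst (T ∘ isL) sk l) id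
  ... | up _ D≡    = _ , D≡
  ... | down sk _  = contradiction (subst (T ∘ isL) sk l) id

  isRight⇒D : ∀ k → T (isRight k) → ∃ λ m → D k ≡ suc m
  isRight⇒D k r with crossing k
  ... | flat sk _ = contradiction (subst (T ∘ isR) sk r) id
  ... | up sk _   = contradiction (subst (T ∘ isR) sk r) id
  ... | down _ D≡ = _ , D≡

  isLeft⇒<end : ∀ k → T (isLeft k) → k ℤ.< end
  isLeft⇒<end k l = ℤ.≰⇒> λ end≤k → ℕ.0≢1+n (trans
    (sym (D-end (k ℤ.+ + 1) (ℤ.≤-trans end≤k (i≤i+1 k)))) (proj₂ (isLeft⇒D-next k l)))

  isRight⇒<end : ∀ k → T (isRight k) → k ℤ.< end
  isRight⇒<end k r = ℤ.≰⇒> λ end≤k →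
    ℕ.0≢1+n (trans (sym (D-end k end≤k)) (proj₂ (isRight⇒D k r)))

  ¬isLeft∧isRight : ∀ k → T (isLeft k) → ¬ T (isRight k)
  ¬isLeft∧isRight k l r with s k
  ¬isLeft∧isRight k l () | L _

  -- The sorted lists of pairs with left endpoints from `k` on. Continuing from `u + 1` builds in
  -- both the sorting and the distinctness of the left endpoints. The number of pairs is imposed
  -- separately, so that partial matchings can be compared with the number of snakes.
  data Matching (k : ℤ) : List (ℤ × ℤ) → Set where
    []   : Matching k []
    cons : k ℤ.≤ u → u ℤ.< v → T (isLeft u) → T (isRight v) → T (fresh v ps) →
           Matching (u ℤ.+ + 1) ps → Matching k ((u , v) ∷ ps)

  weaken : k ℤ.≤ u → Matching u ps → Matching k ps
  weaken k≤u []                    = []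
  weaken k≤u (cons u≤w w<v l r f m) = cons (ℤ.≤-trans k≤u u≤w) w<v l r f m

  skip : ¬ T (isLeft k) → Matching k ps → Matching (k ℤ.+ + 1) ps
  skip ¬l []                    = []
  skip ¬l (cons k≤u u<v l r f m) with ≤-split k≤u
  ... | inj₁ refl = contradiction l ¬l
  ... | inj₂ k<u  = cons k<u u<v l r f m

  private
    next : ∀ k n → k ℤ.+ + suc n ≡ end → k ℤ.+ + 1 ℤ.+ + n ≡ end
    next k n eq = trans (sym (+-suc-shift k n)) eq

  -- The left endpoints are distinct left snakes. A matching with as many pairs as there are left
  -- snakes can therefore skip none of them.
  length≤count : ∀ k n → k ℤ.+ + n ≡ end → Matching k ps → length ps ≤ count isLeft k n
  length≤count k n eq [] = z≤n
  length≤count k zero eq (cons {u} k≤u _ l _ _ _) = contradiction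
    (subst (ℤ._≤ u) (trans (sym (ℤ.+-identityʳ k)) eq) k≤u) (ℤ.<⇒≱ (isLeft⇒<end u l))
  length≤count k (suc n) eq (cons k≤u u<v l r f m) with ≤-split k≤u
  ... | inj₁ refl rewrite T⇒≡true l = s≤s (length≤count (k ℤ.+ + 1) n (next k n eq) m)
  ... | inj₂ k<u  = ℕ.≤-trans (length≤count (k ℤ.+ + 1) n (next k n eq) (cons k<u u<v l r f m))
    (ℕ.m≤n+m _ (b2n (isLeft k)))

  -- From `k` on, `D` gains 1 at each left snake, loses 1 at each right snake, and ends at 0.
  count-right : ∀ k n → k ℤ.+ + n ≡ end → count isRight k n ≡ count isLeft k n + D k
  count-right k zero eq =
    sym (D-end k (ℤ.≤-reflexive (trans (sym eq) (ℤ.+-identityʳ k))))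
  count-right k (suc n) eq with crossing k | count-right (k ℤ.+ + 1) n (next k n eq)
  ... | flat sk D≡ | ih rewrite sk = trans ih (cong (λ d → count isLeft (k ℤ.+ + 1) n + d) D≡)
  ... | up sk D≡   | ih rewrite sk = trans ih
    (trans (cong (λ d → count isLeft (k ℤ.+ + 1) n + d) D≡) (ℕ.+-suc _ (D k)))
  ... | down sk D≡ | ih rewrite sk = trans (cong suc ih)
    (trans (sym (ℕ.+-suc _ (D (k ℤ.+ + 1)))) (cong (λ d → count isLeft (k ℤ.+ + 1) n + d) (sym D≡)))

  available : List (ℤ × ℤ) → ℤ → Bool
  available ps v = isRight v ∧ fresh v ps

  -- Each pair uses up one right snake of the range, and by freshness no two pairs use the same one.
  count-available : ∀ k n → k ℤ.+ + n ≡ end → Matching k ps →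
                    count (available ps) k n + length ps ≡ count isRight k n
  count-available k n eq [] = trans (ℕ.+-identityʳ _)
    (count-cong k n (λ v _ → ∧-true (isRight v)))
    where
    ∧-true : ∀ b → b ∧ true ≡ b
    ∧-true true  = refl
    ∧-true false = refl
  count-available {ps = (u , w) ∷ ps} k n eq (cons k≤u u<w l r f m) = begin
    count (available ((u , w) ∷ ps)) k n + suc (length ps)
      ≡⟨ ℕ.+-suc _ (length ps) ⟩
    suc (count (available ((u , w) ∷ ps)) k n) + length ps
      ≡⟨ cong (_+ length ps) (count-remove w k n agree removed (T⇒≡true (∧-intro r f))
           (ℤ.≤-trans k≤u (ℤ.<⇒≤ u<w)) (subst (w ℤ.<_) (sym eq) (isRight⇒<end w r))) ⟩
    count (available ps) k n + length ps
      ≡⟨ count-available k n eq (weaken (ℤ.≤-trans k≤u (i≤i+1 u)) m) ⟩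
    count isRight k n ∎
    where
    open ≡-Reasoning
    agree : ∀ v → v ≢ w → available ((u , w) ∷ ps) v ≡ available ps v
    agree v v≢w rewrite dec-false (v ℤ.≟ w) v≢w = refl
    removed : available ((u , w) ∷ ps) w ≡ false
    removed rewrite dec-true (w ℤ.≟ w) refl with isRight w
    ... | true  = refl
    ... | false = refl

  private
    skip-⇔ : ∀ k n → isLeft k ≡ false → ∀ {c} →
             Enumeration c (λ ps → Matching (k ℤ.+ + 1) ps × length ps ≡ count isLeft (k ℤ.+ + 1) n) →
             Enumeration c (λ ps → Matching k ps × length ps ≡ count isLeft k (suc n))
    skip-⇔ k n ¬l = enum-⇔
      (λ { (m , len) → weaken (i≤i+1 k) m , trans len (sym (count-head isLeft k n ¬l)) })
      (λ { (m , len) → skip (subst T ¬l) m , trans len (count-head isLeft k n ¬l) })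

  -- Scanning from right to left, the left snake at k can be matched with any of
  -- the D (k + 1) right snakes beyond it that are still unmatched.
  matchings : ∀ k n → k ℤ.+ + n ≡ end →
              Enumeration (product (map suc (leftHalves k n)))
                          (λ ps → Matching k ps × length ps ≡ count isLeft k n)
  matchings k zero eq = enum-⇔ (λ { refl → [] , refl }) (λ { ([] , _) → refl }) (enum-singleton [])
  matchings k (suc n) eq with crossing k
  ... | flat sk D≡ rewrite mapMaybe-nothing (λ k → leftHalf (s k)) (range (k ℤ.+ + 1) n) (cong leftHalf sk) =
    skip-⇔ k n (cong isL sk) (matchings (k ℤ.+ + 1) n (next k n eq))
  ... | down sk D≡ rewrite mapMaybe-nothing (λ k → leftHalf (s k)) (range (k ℤ.+ + 1) n) (cong leftHalf sk) =
    skip-⇔ k n (cong isL sk) (matchings (k ℤ.+ + 1) n (next k n eq))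
  ... | up sk D≡ rewrite mapMaybe-just (λ k → leftHalf (s k)) (range (k ℤ.+ + 1) n) (cong leftHalf sk) =
    enum-⇔ to from (enum-map attach attach-injective
      (enum-Σ (matchings (k ℤ.+ + 1) n (next k n eq)) partners))
    where
    IsPartner : List (ℤ × ℤ) → ℤ → Set
    IsPartner ps v = k ℤ.+ + 1 ℤ.≤ v × v ℤ.< k ℤ.+ + 1 ℤ.+ + n × T (available ps v)

    partners-count : Matching (k ℤ.+ + 1) ps → length ps ≡ count isLeft (k ℤ.+ + 1) n →
                     count (available ps) (k ℤ.+ + 1) n ≡ suc (D k)
    -- The later right snakes outnumber the later left ones by `D (k + 1)`, and a full matching of
    -- the latter occupies one right snake for each.
    partners-count {ps} m len = ℕ.+-cancelʳ-≡ (length ps) _ _ (begin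
      count (available ps) (k ℤ.+ + 1) n + length ps
        ≡⟨ count-available (k ℤ.+ + 1) n (next k n eq) m ⟩
      count isRight (k ℤ.+ + 1) n
        ≡⟨ count-right (k ℤ.+ + 1) n (next k n eq) ⟩
      count isLeft (k ℤ.+ + 1) n + D (k ℤ.+ + 1)
        ≡⟨ cong₂ _+_ (sym len) D≡ ⟩
      length ps + suc (D k)
        ≡⟨ ℕ.+-comm (length ps) _ ⟩
      suc (D k) + length ps ∎)
      where open ≡-Reasoning

    partners : ∀ {ps} → Matching (k ℤ.+ + 1) ps × length ps ≡ count isLeft (k ℤ.+ + 1) n →
               Enumeration (suc (D k)) (IsPartner ps)
    partners {ps} (m , len) = subst (λ c → Enumeration c (IsPartner ps)) (partners-count m len)
      (enum-range (available ps) (k ℤ.+ + 1) n)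

    attach : ℤ × List (ℤ × ℤ) → List (ℤ × ℤ)
    attach (v , ps) = (k , v) ∷ ps

    attach-injective : ∀ {x y} → attach x ≡ attach y → x ≡ y
    attach-injective refl = refl

    left-k : isLeft k ≡ true
    left-k = cong isL sk

    to : ∀ {qs} → (∃ λ ((v , ps) : ℤ × List (ℤ × ℤ)) →
           ((Matching (k ℤ.+ + 1) ps × length ps ≡ count isLeft (k ℤ.+ + 1) n) × IsPartner ps v)
           × attach (v , ps) ≡ qs) →
         Matching k qs × length qs ≡ count isLeft k (suc n)
    to ((v , ps) , ((m , len) , k<v , _ , av) , refl) =
      cons ℤ.≤-refl (+1≤⇒< k<v) (≡true⇒T left-k) (∧-fst (isRight v) av) (∧-snd (isRight v) av) m
      , trans (cong suc len) (sym (count-head isLeft k n left-k))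

    from : ∀ {qs} → Matching k qs × length qs ≡ count isLeft k (suc n) →
           ∃ λ ((v , ps) : ℤ × List (ℤ × ℤ)) →
           ((Matching (k ℤ.+ + 1) ps × length ps ≡ count isLeft (k ℤ.+ + 1) n) × IsPartner ps v)
           × attach (v , ps) ≡ qs
    from (m , len) with trans len (count-head isLeft k n left-k)
    from {(u , v) ∷ ps} (cons k≤u u<v l r f m , _) | len with ≤-split k≤u
    ... | inj₁ refl = (v , ps)
      , ((m , ℕ.suc-injective len)
        , <⇒+1≤ u<v , subst (v ℤ.<_) (sym (next k n eq)) (isRight⇒<end v r) , ∧-intro r f)
      , refl
    -- A list that starts beyond `k` would have one pair more than there are left snakes beyond `k`.
    ... | inj₂ k<u  = contradiction
      (subst (_≤ count isLeft (k ℤ.+ + 1) n) len (length≤count (k ℤ.+ + 1) n (next k n eq) (cons k<u u<v l r f m)))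
      (ℕ.<⇒≱ ℕ.≤-refl)

  -- Each level is climbed through as often as it is descended through, apart
  -- from the D k levels below the starting height.
  products-agree : ∀ k n → k ℤ.+ + n ≡ end →
                   product (map suc (rightHalves k n)) ≡ (D k) ! * product (map suc (leftHalves k n))
  products-agree k zero eq
    rewrite D-end k (ℤ.≤-reflexive (trans (sym eq) (ℤ.+-identityʳ k))) = refl
  products-agree k (suc n) eq with crossing k | products-agree (k ℤ.+ + 1) n (next k n eq)
  ... | flat sk D≡ | ih rewrite sk | D≡ = ih
  ... | up sk D≡ | ih rewrite sk | D≡ =
    trans ih (regroup (D k) ((D k) !) (product (map suc (leftHalves (k ℤ.+ + 1) n))))
    where
    regroup : ∀ d f p → (suc d * f) * p ≡ f * (suc d * p)
    regroup = solve-∀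
  ... | down sk D≡ | ih rewrite sk | D≡ =
    trans (cong (suc (D (k ℤ.+ + 1)) *_) ih) (sym (ℕ.*-assoc (suc (D (k ℤ.+ + 1))) ((D (k ℤ.+ + 1)) !) _))

-- Boolean tests on pairs and parity of snake sizes

==⇒≡ : ∀ x y → T (x == y) → x ≡ y
==⇒≡ x y t with x ℤ.≟ y
... | yes x≡y = x≡y

≢⇒T-not-== : ∀ {x y} → x ≢ y → T (not (x == y))
≢⇒T-not-== {x} {y} x≢y rewrite dec-false (x ℤ.≟ y) x≢y = _

-- The membership test inside allDistinct is a local function without a name in
-- scope, which also takes the whole list as a parameter.  Abstracting y ∷ ys turns
-- that parameter into a variable distinct from ys, and then unification finds the
-- function.
mutual
  notIn : ℤ → List ℤ → List ℤ → Bool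
  notIn = _

  allDistinct-∷∷ : ∀ x y ys → allDistinct (x ∷ y ∷ ys) ≡
                   (not (x == y) ∧ notIn x (y ∷ ys) ys) ∧ allDistinct (y ∷ ys)
  allDistinct-∷∷ x y ys with y ∷ ys
  ... | _ = refl

flatten : List (ℤ × ℤ) → List ℤ
flatten []             = []
flatten ((u , v) ∷ ps) = u ∷ v ∷ flatten ps

-- Stated for any `f` with these values, because a second copy of the pattern lambda in
-- `isIntervalSet` would be a different function. The actual one is supplied by unification.
concatMap-flatten : (f : ℤ × ℤ → List ℤ) → (∀ u v → f (u , v) ≡ u ∷ v ∷ []) →
                    ∀ ps → concatMap f ps ≡ flatten ps
concatMap-flatten f f≗ []             = refl
concatMap-flatten f f≗ ((u , v) ∷ ps) rewrite f≗ u v = cong (λ xs → u ∷ v ∷ xs) (concatMap-flatten f f≗ ps)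

halfOdd-even : ∀ n → halfOdd (n + n) ≡ nothing
halfOdd-even zero = refl
halfOdd-even (suc n) rewrite ℕ.+-suc n n | halfOdd-even n = refl

halfOdd-odd : ∀ n → halfOdd (suc (n + n)) ≡ just n
halfOdd-odd zero = refl
halfOdd-odd (suc n) rewrite ℕ.+-suc n n | halfOdd-odd n = refl

if-const : ∀ {A : Set} b {x y : A} → y ≡ x → (if b then x else y) ≡ x
if-const true  _   = refl
if-const false y≡x = y≡x

-- The profile of a skew shape

module Skew (la mu : List ℕ) (pl : IsPartition la) (pm : IsPartition mu) (inc : mu ⊆ₚ la) where

  -- The cells of content k in λ/μ are the (i , k + i) with M k < i ≤ H k; there are D k of them.
  H M D : ℤ → ℕ
  H = height la
  M = height mu
  D k = H k ∸ M k

  M≤H : ∀ k → M k ≤ H k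
  M≤H k with M k in eq
  ... | zero  = z≤n
  ... | suc n = fits⇒≤height pl k n
    (ℤ.≤-trans (≤height⇒fits pm k n (ℕ.≤-reflexive (sym eq))) (+≤+ (inc (suc n))))

  inSkew-true : ∀ k n → M k < n → n ≤ H k → inSkew la mu n (k ℤ.+ + n) ≡ true
  inSkew-true k (suc n) M<n n≤H = T⇒≡true (∧-intro
    (ℤ.≤⇒≤ᵇ (≰⇒+1≤ (ℕ.<⇒≱ M<n ∘ fits⇒≤height pm k n)))
    (ℤ.≤⇒≤ᵇ (≤height⇒fits pl k n n≤H)))

  inSkew-false-≤M : ∀ k n → n ≤ M k → inSkew la mu n (k ℤ.+ + n) ≡ false
  inSkew-false-≤M k zero    n≤M = refl
  inSkew-false-≤M k (suc n) n≤M = ¬T⇒≡false λ t →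
    ℤ.<⇒≱ (+1≤⇒< (ℤ.≤ᵇ⇒≤ (∧-fst ((+ row mu (suc n)) <ᵇ (k ℤ.+ + suc n)) t))) (≤height⇒fits pm k n n≤M)

  inSkew-false->H : ∀ k n → H k < n → inSkew la mu n (k ℤ.+ + n) ≡ false
  inSkew-false->H k (suc n) H<n = ¬T⇒≡false λ t → ℕ.<⇒≱ H<n
    (fits⇒≤height pl k n (ℤ.≤ᵇ⇒≤ (∧-snd ((+ row mu (suc n)) <ᵇ (k ℤ.+ + suc n)) t)))

  -- Snake sizes and the changes of `D`

  cells : ℤ → ℕ → ℕ
  cells k zero    = 0
  cells k (suc n) = b2n (inSkew la mu (suc n) (k ℤ.+ + suc n)) + cells k n

  cells-count : ∀ k n → n ≤ H k → cells k n ≡ n ∸ M k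
  cells-count k zero    _   = sym (ℕ.0∸n≡0 (M k))
  cells-count k (suc n) n<H with M k ≤? n
  ... | yes M≤n rewrite inSkew-true k (suc n) (s≤s M≤n) n<H =
    trans (cong suc (cells-count k n (ℕ.<⇒≤ n<H))) (sym (ℕ.+-∸-assoc 1 M≤n))
  ... | no  M≰n rewrite inSkew-false-≤M k (suc n) (ℕ.≰⇒> M≰n) =
    trans (cells-count k n (ℕ.<⇒≤ n<H))
      (trans (ℕ.m≤n⇒m∸n≡0 (ℕ.≰⇒≥ M≰n)) (sym (ℕ.m≤n⇒m∸n≡0 (ℕ.≰⇒> M≰n))))

  cells-H : ∀ k → cells k (H k) ≡ D k
  cells-H k = cells-count k (H k) ℕ.≤-refl

  -- The snake at a horizontal step zigzags through the diagonals `k + 1` and `k`, with one position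
  -- on each in every row.
  hSize-cells : ∀ k n → hSize la mu n (k ℤ.+ + 1 ℤ.+ + n) ≡ cells (k ℤ.+ + 1) n + cells k n
  hSize-cells k zero = refl
  hSize-cells k (suc n)
    rewrite +-suc-1 (k ℤ.+ + 1) n | +-suc-shift k n | hSize-cells k n =
    +-interchange (b2n (inSkew la mu (suc n) (k ℤ.+ + 1 ℤ.+ + suc n)))
      (b2n (inSkew la mu (suc n) (k ℤ.+ + 1 ℤ.+ + n))) (cells (k ℤ.+ + 1) n) (cells k n)

  -- At a vertical step the zigzag begins with the diagonal `k` and reaches the diagonal `k + 1` one
  -- row higher.
  vSize-cells : ∀ k n → vSize la mu (suc n) (k ℤ.+ + suc n) ≡ cells k (suc n) + cells (k ℤ.+ + 1) n
  vSize-cells k zero = refl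
  vSize-cells k (suc n)
    rewrite +-suc-1 k (suc n) | vSize-cells k n | +-suc-shift k (suc n) =
    +-interchange (b2n (inSkew la mu (suc (suc n)) (k ℤ.+ + 1 ℤ.+ + suc n)))
      (b2n (inSkew la mu (suc n) (k ℤ.+ + 1 ℤ.+ + suc n))) (cells k (suc n)) (cells (k ℤ.+ + 1) n)

  -- Refines `Crossing` by the direction of the step of μ at climbs and descents, which decides the
  -- corners in the computation of the rank.
  data SkewStep (k : ℤ) : Set where
    flat : q la mu k ≡ O → D (k ℤ.+ + 1) ≡ D k → SkewStep k
    up   : q la mu k ≡ L (D k) → D (k ℤ.+ + 1) ≡ suc (D k) → rising mu k ≡ true → SkewStep k
    down : q la mu k ≡ R (D (k ℤ.+ + 1)) → D k ≡ suc (D (k ℤ.+ + 1)) → rising mu k ≡ false → SkewStep k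

  private
    size-hor : ∀ k → H k ≡ H (k ℤ.+ + 1) →
               hSize la mu (H k) (k ℤ.+ + H k ℤ.+ + 1) ≡ D (k ℤ.+ + 1) + D k
    size-hor k eq = begin
      hSize la mu (H k) (k ℤ.+ + H k ℤ.+ + 1)
        ≡⟨ cong (hSize la mu (H k)) (trans (sym (+-suc-last k (H k))) (+-suc-shift k (H k))) ⟩
      hSize la mu (H k) (k ℤ.+ + 1 ℤ.+ + H k)
        ≡⟨ hSize-cells k (H k) ⟩
      cells (k ℤ.+ + 1) (H k) + cells k (H k)
        ≡⟨ cong₂ _+_ (trans (cong (cells (k ℤ.+ + 1)) eq) (cells-H (k ℤ.+ + 1))) (cells-H k) ⟩
      D (k ℤ.+ + 1) + D k ∎
      where open ≡-Reasoning

    size-ver : ∀ k → H k ≡ suc (H (k ℤ.+ + 1)) →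
               vSize la mu (H k) (k ℤ.+ + H k) ≡ D k + D (k ℤ.+ + 1)
    size-ver k eq = begin
      vSize la mu (H k) (k ℤ.+ + H k)
        ≡⟨ cong (λ n → vSize la mu n (k ℤ.+ + n)) eq ⟩
      vSize la mu (suc H′) (k ℤ.+ + suc H′)
        ≡⟨ vSize-cells k H′ ⟩
      cells k (suc H′) + cells (k ℤ.+ + 1) H′
        ≡⟨ cong₂ _+_ (trans (cong (cells k) (sym eq)) (cells-H k)) (cells-H (k ℤ.+ + 1)) ⟩
      D k + D (k ℤ.+ + 1) ∎
      where
      open ≡-Reasoning
      H′ = H (k ℤ.+ + 1)

  skewStep : ∀ k → SkewStep k
  skewStep k with stepView pl k | stepView pm k
  -- Parallel steps give `O` in either case: if they coincide by definition, and otherwise because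
  -- the size `D (k + 1) + D k` is twice `D k`, hence even.
  ... | horizontal la-hor H≡ | horizontal mu-hor M≡ = flat q≡ (sym D≡)
    where
    D≡ : D k ≡ D (k ℤ.+ + 1)
    D≡ = cong₂ _∸_ H≡ M≡
    q≡ : q la mu k ≡ O
    q≡ rewrite la-hor | mu-hor | size-hor k H≡ | sym D≡ | halfOdd-even (D k) =
      if-const (((k ℤ.+ + H k) == (k ℤ.+ + M k)) ∧ ((+ H k) == (+ M k))) refl
  ... | vertical la-ver H≡ | vertical mu-ver M≡ = flat q≡ (sym D≡)
    where
    D≡ : D k ≡ D (k ℤ.+ + 1)
    D≡ = cong₂ _∸_ H≡ M≡
    q≡ : q la mu k ≡ O
    q≡ rewrite la-ver | mu-ver | size-ver k H≡ | sym D≡ | halfOdd-even (D k) =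
      if-const (((k ℤ.+ + H k) == (k ℤ.+ + M k)) ∧ ((+ H k) == (+ M k))) refl
  ... | horizontal la-hor H≡ | vertical mu-ver M≡ = up q≡ D≡ mu-ver
    where
    D≡ : D (k ℤ.+ + 1) ≡ suc (D k)
    D≡ = begin
      H (k ℤ.+ + 1) ∸ M (k ℤ.+ + 1)     ≡⟨ cong (_∸ M (k ℤ.+ + 1)) (sym H≡) ⟩
      suc (H k) ∸ suc (M (k ℤ.+ + 1))   ≡⟨ cong (suc (H k) ∸_) (sym M≡) ⟩
      suc (H k) ∸ M k                   ≡⟨ ℕ.+-∸-assoc 1 (M≤H k) ⟩
      suc (D k) ∎
      where open ≡-Reasoning
    q≡ : q la mu k ≡ L (D k)
    q≡ rewrite la-hor | mu-ver | size-hor k H≡ | D≡ | halfOdd-odd (D k) = refl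
  ... | vertical la-ver H≡ | horizontal mu-hor M≡ = down q≡ D≡ mu-hor
    where
    D≡ : D k ≡ suc (D (k ℤ.+ + 1))
    D≡ = trans (cong₂ _∸_ H≡ M≡) (ℕ.+-∸-assoc 1 (M≤H (k ℤ.+ + 1)))
    q≡ : q la mu k ≡ R (D (k ℤ.+ + 1))
    q≡ rewrite la-ver | mu-hor | size-ver k H≡ | D≡ | halfOdd-odd (D (k ℤ.+ + 1)) = refl

  crossing : ∀ k → Crossing (q la mu) D k
  crossing k with skewStep k
  ... | flat qk D≡   = flat qk D≡
  ... | up qk D≡ _   = up qk D≡
  ... | down qk D≡ _ = down qk D≡

  -- Vanishing of `D` outside the index range

  nonpositive⇒≤M : ∀ k n → k ℤ.+ + n ℤ.≤ + 0 → n ≤ M k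
  nonpositive⇒≤M k zero    _     = z≤n
  nonpositive⇒≤M k (suc n) k+n≤0 = fits⇒≤height pm k n (ℤ.≤-trans k+n≤0 (+≤+ z≤n))

  -- Both heights also count the positions in columns at most 0. Below the rows of `la` there are no
  -- others, so a diagonal of λ reaching that far is matched by μ.
  length<H⇒H≤M : ∀ k → length la < H k → H k ≤ M k
  length<H⇒H≤M k len<H with H k in eq
  ... | suc n = nonpositive⇒≤M k (suc n)
    (subst (λ r → k ℤ.+ + suc n ℤ.≤ + r) (row-beyond la n (s≤s⁻¹ len<H))
      (≤height⇒fits pl k n (ℕ.≤-reflexive (sym eq))))

  D≡0-left : ∀ k → k ℤ.≤ ℤ.- (+ length la) → D k ≡ 0
  D≡0-left k k≤-len = ℕ.m≤n⇒m∸n≡0 H≤M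
    where
    H≤M : H k ≤ M k
    H≤M with H k ≤? length la
    ... | no  H≰len = length<H⇒H≤M k (ℕ.≰⇒> H≰len)
    ... | yes H≤len = nonpositive⇒≤M k (H k)
      (ℤ.≤-trans (ℤ.+-mono-≤ k≤-len (+≤+ H≤len)) (ℤ.≤-reflexive (ℤ.+-inverseˡ (+ length la))))

  D≡0-right : ∀ k → + row la 1 ℤ.≤ k → D k ≡ 0
  D≡0-right k row≤k = trans (cong (_∸ M k) H≡0) (ℕ.0∸n≡0 (M k))
    where
    H≡0 : H k ≡ 0
    H≡0 with H k in eq
    ... | zero  = refl
    ... | suc n = contradiction
      (ℤ.≤-trans (≤height⇒fits pl k n (ℕ.≤-reflexive (sym eq)))
        (ℤ.≤-trans (+≤+ (row-antitone pl z≤n)) row≤k))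
      (ℤ.<⇒≱ (+1≤⇒< (ℤ.+-monoʳ-≤ k (+≤+ (s≤s (z≤n {n}))))))

  -- Interval sets as matchings

  open Matching (q la mu) D (+ row la 1) crossing D≡0-right

  -- A climb before the start would make `D` positive at an index where it is 0. This confines the
  -- left endpoints, a priori arbitrary integers, to the finite range.
  isLeft⇒≥start : ∀ k → T (isLeft k) → ℤ.- (+ length la) ℤ.≤ k
  isLeft⇒≥start k l = ℤ.≮⇒≥ λ k<start → ℕ.0≢1+n
    (trans (sym (D≡0-left (k ℤ.+ + 1) (<⇒+1≤ k<start))) (proj₂ (isLeft⇒D-next k l)))

  sorted-tail : ∀ {u v} ps → T (sortedU ((u , v) ∷ ps)) →
                T (sortedU ps) × (∀ {u′ v′ qs} → ps ≡ (u′ , v′) ∷ qs → u ℤ.+ + 1 ℤ.≤ u′)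
  sorted-tail         []               t = _ , λ ()
  sorted-tail {u} {v} ((u′ , v′) ∷ ps) t =
    ∧-snd (u <ᵇ u′) t , λ { refl → ℤ.≤ᵇ⇒≤ (∧-fst (u <ᵇ u′) t) }

  -- The list `ys` is a separate variable because the test keeps it fixed while it recurses through
  -- `flatten ps`. The same holds for the two lemmas below.
  notIn⇒fresh : ∀ w ys ps → T (notIn w ys (flatten ps)) → T (fresh w ps)
  notIn⇒fresh w ys []             t = _
  notIn⇒fresh w ys ((u , v) ∷ ps) t = ∧-intro (∧-fst (not (w == v)) t′)
    (notIn⇒fresh w ys ps (∧-snd (not (w == v)) t′))
    where
    t′ = ∧-snd (not (w == u)) t

  -- This separates a left endpoint from all later pairs: it is smaller than their left endpoints,
  -- hence than their right endpoints as well.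
  <-notIn : ∀ {w k ps} ys → w ℤ.< k → Matching k ps → T (notIn w ys (flatten ps))
  <-notIn ys w<k [] = _
  <-notIn ys w<k (cons {u} {v} k≤u u<v _ _ _ m) =
    ∧-intro (≢⇒T-not-== (ℤ.<⇒≢ w<u))
      (∧-intro (≢⇒T-not-== (ℤ.<⇒≢ (ℤ.<-trans w<u u<v)))
        (<-notIn ys (ℤ.<-≤-trans w<u (i≤i+1 u)) m))
    where
    w<u = ℤ.<-≤-trans w<k k≤u

  -- A right snake differs from the left endpoints by its type and from the right endpoints by
  -- freshness.
  fresh⇒notIn : ∀ {w k ps} ys → T (isRight w) → T (fresh w ps) → Matching k ps →
                T (notIn w ys (flatten ps))
  fresh⇒notIn ys r f [] = _
  fresh⇒notIn {w} ys r f (cons {u} {v} _ _ l _ _ m) =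
    ∧-intro (≢⇒T-not-== {w} {u} λ { refl → ¬isLeft∧isRight u l r })
      (∧-intro (∧-fst (not (w == v)) f) (fresh⇒notIn ys r (∧-snd (not (w == v)) f) m))

  toMatching : ∀ k ps → (∀ {u v qs} → ps ≡ (u , v) ∷ qs → k ℤ.≤ u) →
               T (sortedU ps) → T (allDistinct (flatten ps)) → T (pairsOK la mu ps) → Matching k ps
  toMatching k []             k≤ srt dst ok = []
  toMatching k ((u , v) ∷ ps) k≤ srt dst ok =
    cons (k≤ refl) (+1≤⇒< (ℤ.≤ᵇ⇒≤ (∧-fst (u <ᵇ v) ok))) (∧-fst (isLeft u) ok₂) (∧-fst (isRight v) ok₃)
      (notIn⇒fresh v (flatten ps) ps (∧-fst (notIn v (flatten ps) (flatten ps)) dst₂))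
      (toMatching (u ℤ.+ + 1) ps (proj₂ (sorted-tail ps srt)) (proj₁ (sorted-tail ps srt))
        (∧-snd (notIn v (flatten ps) (flatten ps)) dst₂) (∧-snd (isRight v) ok₃))
    where
    ok₂ = ∧-snd (u <ᵇ v) ok
    ok₃ = ∧-snd (isLeft u) ok₂
    dst₂ = ∧-snd (notIn u (v ∷ flatten ps) (v ∷ flatten ps)) dst

  matching⇒sorted : ∀ {k ps} → Matching k ps → T (sortedU ps)
  matching⇒sorted []                                        = _
  matching⇒sorted (cons _ _ _ _ _ [])                       = _
  matching⇒sorted (cons _ _ _ _ _ m@(cons u<u′ _ _ _ _ _)) =
    ∧-intro (ℤ.≤⇒≤ᵇ u<u′) (matching⇒sorted m)

  matching⇒distinct : ∀ {k ps} → Matching k ps → T (allDistinct (flatten ps))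
  matching⇒distinct [] = _
  matching⇒distinct (cons {u} {v} {ps} k≤u u<v l r f m) =
    ∧-intro (∧-intro (≢⇒T-not-== (ℤ.<⇒≢ u<v)) (<-notIn (v ∷ flatten ps) (+1≤⇒< ℤ.≤-refl) m))
      (∧-intro (fresh⇒notIn (flatten ps) r f m) (matching⇒distinct m))

  matching⇒pairsOK : ∀ {k ps} → Matching k ps → T (pairsOK la mu ps)
  matching⇒pairsOK []                    = _
  matching⇒pairsOK (cons _ u<v l r _ m) =
    ∧-intro (ℤ.≤⇒≤ᵇ (<⇒+1≤ u<v)) (∧-intro l (∧-intro r (matching⇒pairsOK m)))

  -- The rank is the number of left snakes

  cell : ℤ → ℕ → Bool
  cell k n = inSkew la mu n (k ℤ.+ + n)

  inSkew-outside : ∀ n j → j ℤ.≤ + 0 ⊎ + row la 1 ℤ.< j → inSkew la mu (suc n) j ≡ false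
  inSkew-outside n j (inj₁ j≤0) = ¬T⇒≡false λ t → ℤ.<⇒≱
    (+1≤⇒< (ℤ.≤ᵇ⇒≤ (∧-fst ((+ row mu (suc n)) <ᵇ j) t))) (ℤ.≤-trans j≤0 (+≤+ z≤n))
  inSkew-outside n j (inj₂ row<j) = ¬T⇒≡false λ t → ℤ.<⇒≱ row<j
    (ℤ.≤-trans (ℤ.≤ᵇ⇒≤ (∧-snd ((+ row mu (suc n)) <ᵇ j) t)) (+≤+ (row-antitone pl z≤n)))

  -- From row `M c + 1` on, the diagonal lies in the shape exactly up to row `H c`. The bound
  -- `H c < n + N` says that the `N` inspected rows reach that far.
  diagN-count : ∀ c N n → M c < n → H c < n + N → diagN la mu N n (c ℤ.+ + n) ≡ suc (H c) ∸ n
  diagN-count c zero    n M<n H<n = sym (ℕ.m≤n⇒m∸n≡0 (subst (H c <_) (ℕ.+-identityʳ n) H<n))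
  diagN-count c (suc N) n M<n H<n+N
    rewrite sym (+-suc-last c n)
          | diagN-count c N (suc n) (ℕ.<-trans M<n ℕ.≤-refl) (subst (H c <_) (ℕ.+-suc n N) H<n+N)
    with n ≤? H c
  ... | yes n≤H rewrite inSkew-true c n M<n n≤H = sym (ℕ.+-∸-assoc 1 n≤H)
  ... | no  n≰H rewrite inSkew-false->H c n (ℕ.≰⇒> n≰H) =
    trans (ℕ.m≤n⇒m∸n≡0 (ℕ.<⇒≤ (ℕ.≰⇒> n≰H))) (sym (ℕ.m≤n⇒m∸n≡0 (ℕ.≰⇒> n≰H)))

  -- A diagonal ends within the listed rows or is empty.
  H≤length⊎H≤M : ∀ c → H c ≤ length la ⊎ H c ≤ M c
  H≤length⊎H≤M c with H c ≤? length la
  ... | yes H≤len = inj₁ H≤len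
  ... | no  H≰len = inj₂ (length<H⇒H≤M c (ℕ.≰⇒> H≰len))

  diagSize-corner : ∀ c → diagSize la mu (suc (M c)) (c ℤ.+ + suc (M c)) ≡ D c
  diagSize-corner c = diagN-count c (suc (length la)) (suc (M c)) ℕ.≤-refl (s≤s bound)
    where
    bound : H c ≤ M c + suc (length la)
    bound with H≤length⊎H≤M c
    ... | inj₁ H≤len = ℕ.≤-trans H≤len (ℕ.≤-trans (ℕ.n≤1+n _) (ℕ.m≤n+m _ (M c)))
    ... | inj₂ H≤M   = ℕ.≤-trans H≤M (ℕ.m≤m+n _ _)

  content : ℕ → ℤ
  content t = ℤ.- (+ length la) ℤ.+ + t

  private
    shift-content : ∀ a p t → ℤ.- (a ℤ.+ p) ℤ.+ t ℤ.+ a ≡ t ℤ.- p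
    shift-content = ℤ-Solver.solve-∀

  -- Row n + 1 meets all diagonals of content in [-ℓ(λ), λ₁): the p + 1 = ℓ(λ) - n
  -- lowest of them left of column 1 and the n highest right of column λ₁.
  row-by-content : ∀ (f : ℤ → ℕ) n → n < length la →
                   (∀ j → j ℤ.≤ + 0 ⊎ + row la 1 ℤ.< j → f j ≡ 0) →
                   ∑ (row la 1) (λ b → f (+ suc b)) ≡
                   ∑ (length la + row la 1) (λ t → f (content t ℤ.+ + suc n))
  row-by-content f n n<len vanish with ℕ.m≤n⇒∃[o]m+o≡n n<len
  ... | p , eq = sym (begin
    ∑ (length la + row la 1) g
      ≡⟨ cong (λ N → ∑ N g) (trans (cong (_+ row la 1) (sym eq)) (rearrange n p (row la 1))) ⟩
    ∑ (suc p + (row la 1 + n)) g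
      ≡⟨ ∑-split (suc p) (row la 1 + n) g ⟩
    ∑ (suc p) g + ∑ (row la 1 + n) (λ t → g (suc p + t))
      ≡⟨ cong₂ _+_ (∑-zero (suc p) low) (∑-split (row la 1) n (λ t → g (suc p + t))) ⟩
    ∑ (row la 1) (λ t → g (suc p + t)) + ∑ n (λ t → g (suc p + (row la 1 + t)))
      ≡⟨ cong₂ _+_ (∑-cong (row la 1) (λ t _ → middle t)) (∑-zero n (λ t _ → high t)) ⟩
    ∑ (row la 1) (λ b → f (+ suc b)) + 0
      ≡⟨ ℕ.+-identityʳ _ ⟩
    ∑ (row la 1) (λ b → f (+ suc b)) ∎)
    where
    open ≡-Reasoning
    g : ℕ → ℕ
    g t = f (content t ℤ.+ + suc n)
    rearrange : ∀ n p r → suc n + p + r ≡ suc p + (r + n)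
    rearrange = solve-∀
    column : ∀ t → content t ℤ.+ + suc n ≡ + t ℤ.- + p
    column t = trans (cong (λ m → ℤ.- (+ m) ℤ.+ + t ℤ.+ + suc n) (sym eq))
      (shift-content (+ suc n) (+ p) (+ t))
    cancel : ∀ p s → p ℤ.+ s ℤ.- p ≡ s
    cancel = ℤ-Solver.solve-∀
    column-beyond : ∀ s → content (suc p + s) ℤ.+ + suc n ≡ + suc s
    column-beyond s = trans (column (suc p + s))
      (trans (cong (λ m → + m ℤ.- + p) (sym (ℕ.+-suc p s))) (cancel (+ p) (+ suc s)))
    low : ∀ t → t < suc p → g t ≡ 0
    low t t≤p = vanish _ (inj₁ (subst (ℤ._≤ + 0) (sym (column t)) (ℤ.i≤j⇒i-j≤0 (+≤+ (s≤s⁻¹ t≤p)))))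
    middle : ∀ s → g (suc p + s) ≡ f (+ suc s)
    middle s = cong f (column-beyond s)
    high : ∀ s → g (suc p + (row la 1 + s)) ≡ 0
    high s = vanish _ (inj₂ (subst (+ row la 1 ℤ.<_) (sym (column-beyond (row la 1 + s)))
      (ℤ.+<+ (s≤s (ℕ.m≤m+n _ s)))))

  cornerTerm : (List ℕ → List ℕ → ℕ → ℤ → Bool) → ℕ → ℤ → ℕ
  cornerTerm P n j = if P la mu n j then diagSize la mu n j else 0

  cornerTerm-zero : ∀ P {n j} → P la mu n j ≡ false → cornerTerm P n j ≡ 0
  cornerTerm-zero P {n} {j} ¬P = cong (λ b → if b then diagSize la mu n j else 0) ¬P

  cornerDiag : (List ℕ → List ℕ → ℕ → ℤ → Bool) → ℤ → ℕ
  cornerDiag P c = ∑ (length la) (λ n → cornerTerm P (suc n) (c ℤ.+ + suc n))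

  InSkewOnly : (List ℕ → List ℕ → ℕ → ℤ → Bool) → Set
  InSkewOnly P = ∀ n j → inSkew la mu n j ≡ false → P la mu n j ≡ false

  outsideTop-inSkew : InSkewOnly outsideTop
  outsideTop-inSkew n j ¬in = ¬T⇒≡false (subst T ¬in ∘ ∧-fst (inSkew la mu n j))

  insideTop-inSkew : InSkewOnly insideTop
  insideTop-inSkew n j ¬in = ¬T⇒≡false (subst T ¬in ∘ ∧-fst (inSkew la mu n j))

  cornerSum-by-content : ∀ P → InSkewOnly P →
                         cornerSum P la mu ≡ ∑ (length la + row la 1) (λ t → cornerDiag P (content t))
  cornerSum-by-content P P⇒in = begin
    cornerSum P la mu
      ≡⟨ sum-cells la _ ⟩
    ∑ (length la) (λ a → ∑ (row la 1) (λ b → cornerTerm P (suc a) (+ suc b)))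
      ≡⟨ ∑-cong (length la) (λ a a<len → row-by-content (cornerTerm P (suc a)) a a<len (vanish a)) ⟩
    ∑ (length la) (λ a → ∑ (length la + row la 1) (λ t → cornerTerm P (suc a) (content t ℤ.+ + suc a)))
      ≡⟨ ∑-swap (length la) (length la + row la 1) (λ a t → cornerTerm P (suc a) (content t ℤ.+ + suc a)) ⟩
    ∑ (length la + row la 1) (λ t → cornerDiag P (content t)) ∎
    where
    open ≡-Reasoning
    vanish : ∀ a j → j ℤ.≤ + 0 ⊎ + row la 1 ℤ.< j → cornerTerm P (suc a) j ≡ 0
    vanish a j out = cornerTerm-zero P (P⇒in (suc a) j (inSkew-outside a j out))

  -- On each diagonal only the first cell, in row M c + 1, can be a corner.
  cornerDiag-value : ∀ P c b → InSkewOnly P →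
                     (∀ n → n ≢ M c → P la mu (suc n) (c ℤ.+ + suc n) ≡ false) →
                     (M c < H c → P la mu (suc (M c)) (c ℤ.+ + suc (M c)) ≡ b) →
                     cornerDiag P c ≡ (if b then D c else 0)
  cornerDiag-value P c b P⇒in off at = by-cases
    where
    off-term : ∀ n → n ≢ M c → cornerTerm P (suc n) (c ℤ.+ + suc n) ≡ 0
    off-term n n≢M = cornerTerm-zero P (off n n≢M)
    empty : H c ≤ M c → (if b then D c else 0) ≡ 0
    empty H≤M = trans (cong (λ d → if b then d else 0) (ℕ.m≤n⇒m∸n≡0 H≤M)) (if-const b refl)
    by-cases : cornerDiag P c ≡ (if b then D c else 0)
    by-cases with suc (M c) ≤? H c
    -- On an empty diagonal both branches of the `if` are 0, so `b` has to be identified only when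
    -- `M c < H c`.
    ... | no  M≮H = trans (∑-zero (length la) (λ n _ → zero-term n)) (sym (empty (ℕ.≮⇒≥ M≮H)))
      where
      zero-term : ∀ n → cornerTerm P (suc n) (c ℤ.+ + suc n) ≡ 0
      zero-term n with suc n ≤? M c
      ... | yes n<M = cornerTerm-zero P (P⇒in (suc n) _ (inSkew-false-≤M c (suc n) n<M))
      ... | no  n≮M = cornerTerm-zero P (P⇒in (suc n) _
        (inSkew-false->H c (suc n) (ℕ.≤-<-trans (ℕ.≮⇒≥ M≮H) (ℕ.≰⇒> n≮M))))
    ... | yes M<H with H≤length⊎H≤M c
    ... | inj₂ H≤M   = contradiction H≤M (ℕ.<⇒≱ M<H)
    ... | inj₁ H≤len = trans
      (∑-single (length la) (M c) (ℕ.<-≤-trans M<H H≤len) (λ n _ → off-term n))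
      (trans (cong (λ b → if b then diagSize la mu (suc (M c)) (c ℤ.+ + suc (M c)) else 0) (at M<H))
        (cong (λ d → if b then d else 0) (diagSize-corner c)))

  -- The cell above the first cell of the diagonal `c` has content `c + 1` and row `M c`. It lies
  -- below μ exactly when μ loses a row between the two diagonals, that is, when its step `c` is
  -- vertical.
  cell-next : ∀ c → M c < H c → cell (c ℤ.+ + 1) (M c) ≡ rising mu c
  cell-next c M<H with stepView pm c
  ... | vertical is-ver M≡   = trans (inSkew-true (c ℤ.+ + 1) (M c) (ℕ.≤-reflexive (sym M≡))
    (s≤s⁻¹ (ℕ.≤-trans M<H (height≤suc-next pl c)))) (sym is-ver)
  ... | horizontal is-hor M≡ = trans (inSkew-false-≤M (c ℤ.+ + 1) (M c) (ℕ.≤-reflexive M≡)) (sym is-hor)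

  -- The left neighbour of the first cell of the diagonal `p + 1` has content `p`. It belongs to μ
  -- exactly when the step `p` of μ is vertical.
  cell-previous : ∀ p → M (p ℤ.+ + 1) < H (p ℤ.+ + 1) →
                  cell p (suc (M (p ℤ.+ + 1))) ≡ not (rising mu p)
  cell-previous p M<H with stepView pm p
  ... | vertical is-ver M≡   = trans (inSkew-false-≤M p _ (ℕ.≤-reflexive (sym M≡))) (cong not (sym is-ver))
  ... | horizontal is-hor M≡ = trans (inSkew-true p _ (s≤s (ℕ.≤-reflexive M≡))
    (ℕ.≤-trans M<H (height-next≤ pl p))) (cong not (sym is-hor))

  private
    left-cell : ∀ p n → p ℤ.+ + 1 ℤ.+ + suc n ℤ.- + 1 ≡ p ℤ.+ + suc n
    left-cell p n = trans (+-suc-1 (p ℤ.+ + 1) n) (sym (+-suc-shift p n))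

  -- Writing the diagonal as `p + 1` gives the left neighbour content `p` and the upper one `p + 2`,
  -- without subtraction.
  outsideTop-cells : ∀ p n → outsideTop la mu (suc n) (p ℤ.+ + 1 ℤ.+ + suc n) ≡
    cell (p ℤ.+ + 1) (suc n) ∧ not (cell (p ℤ.+ + 1 ℤ.+ + 1) n) ∧ not (cell p (suc n))
  outsideTop-cells p n = cong₂ (λ x y → cell (p ℤ.+ + 1) (suc n) ∧ not x ∧ not y)
    (cong (inSkew la mu n) (+-suc-shift (p ℤ.+ + 1) n))
    (cong (inSkew la mu (suc n)) (left-cell p n))

  insideTop-cells : ∀ p n → insideTop la mu (suc n) (p ℤ.+ + 1 ℤ.+ + suc n) ≡
    cell (p ℤ.+ + 1) (suc n) ∧ cell (p ℤ.+ + 1 ℤ.+ + 1) n ∧ cell p (suc n) ∧ not (cell (p ℤ.+ + 1) n)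
  insideTop-cells p n = cong (cell (p ℤ.+ + 1) (suc n) ∧_) (cong₂ _∧_
    (cong (inSkew la mu n) (+-suc-shift (p ℤ.+ + 1) n))
    (cong₂ (λ x y → x ∧ not y) (cong (inSkew la mu (suc n)) (left-cell p n))
      (cong (inSkew la mu n) (+-suc-1 (p ℤ.+ + 1) n))))

  -- Below the first cell of a diagonal the left neighbour lies in the shape, since
  -- `M p ≤ M (p + 1) + 1` and `H (p + 1) ≤ H p`.
  outsideTop-off : ∀ p n → n ≢ M (p ℤ.+ + 1) → outsideTop la mu (suc n) (p ℤ.+ + 1 ℤ.+ + suc n) ≡ false
  outsideTop-off p n n≢M with ℕ.<-cmp n (M (p ℤ.+ + 1)) | suc n ≤? H (p ℤ.+ + 1)
  ... | tri≈ _ n≡M _ | _       = contradiction n≡M n≢M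
  ... | tri< n<M _ _ | _       rewrite inSkew-false-≤M (p ℤ.+ + 1) (suc n) n<M = refl
  ... | tri> _ _ M<n | no  n≮H rewrite inSkew-false->H (p ℤ.+ + 1) (suc n) (ℕ.≰⇒> n≮H) = refl
  ... | tri> _ _ M<n | yes n<H = trans (outsideTop-cells p n)
    (trans (cong (λ b → cell (p ℤ.+ + 1) (suc n) ∧ not (cell (p ℤ.+ + 1 ℤ.+ + 1) n) ∧ not b)
      (inSkew-true p (suc n) (s≤s (ℕ.≤-trans (height≤suc-next pm p) M<n))
        (ℕ.≤-trans n<H (height-next≤ pl p))))
      (∧-false₃ (cell (p ℤ.+ + 1) (suc n)) (not (cell (p ℤ.+ + 1 ℤ.+ + 1) n))))
    where
    ∧-false₃ : ∀ a b → a ∧ b ∧ false ≡ false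
    ∧-false₃ a b = trans (cong (a ∧_) (∧-zeroʳ b)) (∧-zeroʳ a)

  -- Below the first cell of a diagonal the upper left neighbour, on the same diagonal, lies in the
  -- shape.
  insideTop-off : ∀ p n → n ≢ M (p ℤ.+ + 1) → insideTop la mu (suc n) (p ℤ.+ + 1 ℤ.+ + suc n) ≡ false
  insideTop-off p n n≢M with ℕ.<-cmp n (M (p ℤ.+ + 1)) | suc n ≤? H (p ℤ.+ + 1)
  ... | tri≈ _ n≡M _ | _       = contradiction n≡M n≢M
  ... | tri< n<M _ _ | _       rewrite inSkew-false-≤M (p ℤ.+ + 1) (suc n) n<M = refl
  ... | tri> _ _ M<n | no  n≮H rewrite inSkew-false->H (p ℤ.+ + 1) (suc n) (ℕ.≰⇒> n≮H) = refl
  ... | tri> _ _ M<n | yes n<H = trans (insideTop-cells p n)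
    (trans (cong (λ b → cell (p ℤ.+ + 1) (suc n) ∧ cell (p ℤ.+ + 1 ℤ.+ + 1) n ∧ cell p (suc n) ∧ not b)
      (inSkew-true (p ℤ.+ + 1) n M<n (ℕ.<⇒≤ n<H)))
      (∧-false₄ (cell (p ℤ.+ + 1) (suc n)) (cell (p ℤ.+ + 1 ℤ.+ + 1) n) (cell p (suc n))))
    where
    ∧-false₄ : ∀ a b c → a ∧ b ∧ c ∧ false ≡ false
    ∧-false₄ a b c = trans (cong (λ z → a ∧ b ∧ z) (∧-zeroʳ c))
      (trans (cong (a ∧_) (∧-zeroʳ b)) (∧-zeroʳ a))

  outsideDiag : ∀ p → cornerDiag outsideTop (p ℤ.+ + 1) ≡
                (if not (rising mu (p ℤ.+ + 1)) ∧ rising mu p then D (p ℤ.+ + 1) else 0)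
  outsideDiag p = cornerDiag-value outsideTop c _ outsideTop-inSkew
    (outsideTop-off p) λ M<H → begin
      outsideTop la mu (suc (M c)) (c ℤ.+ + suc (M c))
        ≡⟨ outsideTop-cells p (M c) ⟩
      cell c (suc (M c)) ∧ not (cell (c ℤ.+ + 1) (M c)) ∧ not (cell p (suc (M c)))
        ≡⟨ cong₂ _∧_ (inSkew-true c (suc (M c)) ℕ.≤-refl M<H)
             (cong₂ _∧_ (cong not (cell-next c M<H))
               (trans (cong not (cell-previous p M<H)) (not-involutive (rising mu p)))) ⟩
      not (rising mu c) ∧ rising mu p ∎
    where
    open ≡-Reasoning
    c = p ℤ.+ + 1

  insideDiag : ∀ p → cornerDiag insideTop (p ℤ.+ + 1) ≡
               (if rising mu (p ℤ.+ + 1) ∧ not (rising mu p) then D (p ℤ.+ + 1) else 0)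
  insideDiag p = cornerDiag-value insideTop c _ insideTop-inSkew
    (insideTop-off p) λ M<H → begin
      insideTop la mu (suc (M c)) (c ℤ.+ + suc (M c))
        ≡⟨ insideTop-cells p (M c) ⟩
      cell c (suc (M c)) ∧ cell (c ℤ.+ + 1) (M c) ∧ cell p (suc (M c)) ∧ not (cell c (M c))
        ≡⟨ cong₂ _∧_ (inSkew-true c (suc (M c)) ℕ.≤-refl M<H)
             (cong₂ _∧_ (cell-next c M<H)
               (cong₂ _∧_ (cell-previous p M<H) (cong not (inSkew-false-≤M c (M c) ℕ.≤-refl)))) ⟩
      rising mu c ∧ not (rising mu p) ∧ true
        ≡⟨ cong (rising mu c ∧_) (∧-identityʳ (not (rising mu p))) ⟩
      rising mu c ∧ not (rising mu p) ∎
    where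
    open ≡-Reasoning
    c = p ℤ.+ + 1

  -- μ is vertical at climbs of `D` and horizontal at descents, so weighting the change of `D` by
  -- `rising mu c` keeps the climbs and removes the descents.
  rising-increment : ∀ c → b2n (rising mu c) * D (c ℤ.+ + 1) ≡ b2n (rising mu c) * D c + b2n (isLeft c)
  rising-increment c with skewStep c
  ... | flat qc D≡ = trans (cong (λ d → b2n (rising mu c) * d) D≡)
    (trans (sym (ℕ.+-identityʳ _))
      (cong (λ s → b2n (rising mu c) * D c + b2n (isL s)) (sym qc)))
  ... | up qc D≡ is-ver = trans
    (cong₂ (λ b d → b2n b * d) is-ver D≡)
    (trans (one-more (D c))
      (cong₂ (λ b s → b2n b * D c + b2n (isL s)) (sym is-ver) (sym qc)))
    where
    one-more : ∀ d → 1 * suc d ≡ 1 * d + 1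
    one-more = solve-∀
  ... | down qc D≡ is-hor = trans
    (cong (λ b → b2n b * D (c ℤ.+ + 1)) is-hor)
    (cong₂ (λ b s → b2n b * D c + b2n (isL s)) (sym is-hor) (sym qc))

  -- Outside minus inside contribution at `c` is `rising mu p - rising mu c`, read as 0 or 1, times
  -- `D c`. Adding `rising-increment` brings this into the form required by `∑-telescope`.
  corner-balance : ∀ p → let c = p ℤ.+ + 1 in
    cornerDiag outsideTop c + b2n (rising mu c) * D (c ℤ.+ + 1) ≡
    cornerDiag insideTop c + b2n (rising mu p) * D c + b2n (isLeft c)
  corner-balance p = begin
    cornerDiag outsideTop c + b2n (rising mu c) * D (c ℤ.+ + 1)
      ≡⟨ cong₂ _+_ (outsideDiag p) (rising-increment c) ⟩
    outer (rising mu c) (rising mu p) + (b2n (rising mu c) * D c + b2n (isLeft c))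
      ≡⟨ sym (ℕ.+-assoc (outer (rising mu c) (rising mu p)) _ _) ⟩
    outer (rising mu c) (rising mu p) + b2n (rising mu c) * D c + b2n (isLeft c)
      ≡⟨ cong (_+ b2n (isLeft c)) (exchange (rising mu c) (rising mu p)) ⟩
    inner (rising mu c) (rising mu p) + b2n (rising mu p) * D c + b2n (isLeft c)
      ≡⟨ cong (λ x → x + b2n (rising mu p) * D c + b2n (isLeft c)) (sym (insideDiag p)) ⟩
    cornerDiag insideTop c + b2n (rising mu p) * D c + b2n (isLeft c) ∎
    where
    open ≡-Reasoning
    c = p ℤ.+ + 1
    outer inner : Bool → Bool → ℕ
    outer a b = if not a ∧ b then D c else 0
    inner a b = if a ∧ not b then D c else 0
    exchange : ∀ a b → outer a b + b2n a * D c ≡ inner a b + b2n b * D c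
    exchange true  true  = refl
    exchange true  false = refl
    exchange false true  = refl
    exchange false false = refl

  leftCount : ℕ
  leftCount = count isLeft (ℤ.- (+ length la)) (length la + row la 1)

  content-end : content (length la + row la 1) ≡ + row la 1
  content-end = cancel (+ length la) (+ row la 1)
    where
    cancel : ∀ a b → ℤ.- a ℤ.+ (a ℤ.+ b) ≡ b
    cancel = ℤ-Solver.solve-∀

  outside≡inside+left : cornerSum outsideTop la mu ≡ cornerSum insideTop la mu + leftCount
  outside≡inside+left = begin
    cornerSum outsideTop la mu
      ≡⟨ cornerSum-by-content outsideTop outsideTop-inSkew ⟩
    ∑ N A
      ≡⟨ sym (trans (cong (λ e → ∑ N A + e) E-end) (ℕ.+-identityʳ _)) ⟩
    ∑ N A + E N
      ≡⟨ ∑-telescope N A B E ℓ balance ⟩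
    ∑ N B + E 0 + ∑ N ℓ
      ≡⟨ cong₂ (λ e l → ∑ N B + e + l) E-start (sym (count≡∑ isLeft (ℤ.- (+ length la)) N)) ⟩
    ∑ N B + 0 + leftCount
      ≡⟨ cong (_+ leftCount) (ℕ.+-identityʳ (∑ N B)) ⟩
    ∑ N B + leftCount
      ≡⟨ cong (_+ leftCount) (sym (cornerSum-by-content insideTop insideTop-inSkew)) ⟩
    cornerSum insideTop la mu + leftCount ∎
    where
    open ≡-Reasoning
    N = length la + row la 1
    previous : ℕ → ℤ
    previous t = content t ℤ.- + 1
    A B E ℓ : ℕ → ℕ
    A t = cornerDiag outsideTop (content t)
    B t = cornerDiag insideTop (content t)
    E t = b2n (rising mu (previous t)) * D (content t)
    ℓ t = b2n (isLeft (content t))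
    previous+1 : ∀ t → previous t ℤ.+ + 1 ≡ content t
    previous+1 t = trans (ℤ.+-assoc (content t) (ℤ.- (+ 1)) (+ 1)) (ℤ.+-identityʳ (content t))
    content-suc : ∀ t → content t ℤ.+ + 1 ≡ content (suc t)
    content-suc t = sym (+-suc-last (ℤ.- (+ length la)) t)
    previous-suc : ∀ t → previous (suc t) ≡ content t
    previous-suc t = +-suc-1 (ℤ.- (+ length la)) t
    balance : ∀ t → A t + E (suc t) ≡ B t + E t + ℓ t
    balance t = trans
      (cong₂ (λ r d → A t + b2n (rising mu r) * D d) (previous-suc t) (sym (content-suc t)))
      (subst (λ c → cornerDiag outsideTop c + b2n (rising mu c) * D (c ℤ.+ + 1) ≡
          cornerDiag insideTop c + b2n (rising mu (previous t)) * D c + b2n (isLeft c))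
        (previous+1 t) (corner-balance (previous t)))
    E-start : E 0 ≡ 0
    E-start = trans (cong (λ d → b2n (rising mu (previous 0)) * d)
      (D≡0-left (content 0) (ℤ.≤-reflexive (ℤ.+-identityʳ _)))) (ℕ.*-zeroʳ (b2n (rising mu (previous 0))))
    E-end : E N ≡ 0
    E-end = trans (cong (λ d → b2n (rising mu (previous N)) * d)
      (D≡0-right (content N) (ℤ.≤-reflexive (sym content-end)))) (ℕ.*-zeroʳ (b2n (rising mu (previous N))))

  rank≡leftCount : rank la mu ≡ + leftCount
  rank≡leftCount = trans (cong (λ x → + x ℤ.- + cornerSum insideTop la mu) outside≡inside+left)
    (cancel (+ cornerSum insideTop la mu) (+ leftCount))
    where
    cancel : ∀ a b → a ℤ.+ b ℤ.- a ≡ b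
    cancel = ℤ-Solver.solve-∀

  -- Counting interval sets and the two products

  isIntervalSet-flatten : ∀ ps → isIntervalSet la mu ps ≡
    ((+ length ps) == rank la mu) ∧ sortedU ps ∧ allDistinct (flatten ps) ∧ pairsOK la mu ps
  isIntervalSet-flatten ps = cong
    (λ xs → ((+ length ps) == rank la mu) ∧ sortedU ps ∧ allDistinct xs ∧ pairsOK la mu ps)
    (concatMap-flatten _ (λ _ _ → refl) ps)

  pairsOK-first : ∀ ps → T (pairsOK la mu ps) →
                  ∀ {u v qs} → ps ≡ (u , v) ∷ qs → ℤ.- (+ length la) ℤ.≤ u
  pairsOK-first ((u , v) ∷ ps) ok refl = isLeft⇒≥start u (∧-fst (isLeft u) (∧-snd (u <ᵇ v) ok))

  intervalSets : Enumeration (product (map suc (leftHalves (ℤ.- (+ length la)) (length la + row la 1))))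
                             (λ ps → T (isIntervalSet la mu ps))
  intervalSets = enum-⇔ to from (matchings (ℤ.- (+ length la)) (length la + row la 1) content-end)
    where
    to : ∀ {ps} → Matching (ℤ.- (+ length la)) ps × length ps ≡ leftCount → T (isIntervalSet la mu ps)
    to {ps} (m , len) = subst T (sym (isIntervalSet-flatten ps)) (∧-intro
      (≡true⇒T (dec-true (+ length ps ℤ.≟ rank la mu) (trans (cong +_ len) (sym rank≡leftCount))))
      (∧-intro (matching⇒sorted m) (∧-intro (matching⇒distinct m) (matching⇒pairsOK m))))
    from : ∀ {ps} → T (isIntervalSet la mu ps) → Matching (ℤ.- (+ length la)) ps × length ps ≡ leftCount
    from {ps} t =
        toMatching (ℤ.- (+ length la)) ps (pairsOK-first ps ok) (∧-fst (sortedU ps) t₂)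
          (∧-fst (allDistinct (flatten ps)) t₃) ok
      , ℤ.+-injective (trans (==⇒≡ (+ length ps) (rank la mu) (∧-fst same-size t₁)) rank≡leftCount)
      where
      same-size = (+ length ps) == rank la mu
      t₁ = subst T (isIntervalSet-flatten ps) t
      t₂ = ∧-snd same-size t₁
      t₃ = ∧-snd (sortedU ps) t₂
      ok = ∧-snd (allDistinct (flatten ps)) t₃

  left-product : product (map suc (leftHalves (ℤ.- (+ length la)) (length la + row la 1))) ≡
                 product (map suc (leftSnakeHalfLengths la mu))
  left-product = cong (λ ks → product (map suc (mapMaybe (λ k → leftHalf (q la mu k)) ks)))
    (sym (map-upTo≡range (ℤ.- (+ length la)) (length la + row la 1)))

  -- At the first index `D` is 0, so the factorial in `products-agree` is `0 !`, which is 1.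
  right-product : product (map suc (leftHalves (ℤ.- (+ length la)) (length la + row la 1))) ≡
                  product (map suc (rightSnakeHalfLengths la mu))
  right-product = begin
    product (map suc (leftHalves start N))
      ≡⟨ sym (ℕ.*-identityˡ _) ⟩
    0 ! * product (map suc (leftHalves start N))
      ≡⟨ cong (λ d → d ! * product (map suc (leftHalves start N))) (sym (D≡0-left start ℤ.≤-refl)) ⟩
    D start ! * product (map suc (leftHalves start N))
      ≡⟨ sym (products-agree start N content-end) ⟩
    product (map suc (rightHalves start N))
      ≡⟨ cong (λ ks → product (map suc (mapMaybe (λ k → rightHalf (q la mu k)) ks)))
           (sym (map-upTo≡range start N)) ⟩
    product (map suc (rightSnakeHalfLengths la mu)) ∎
    where
    open ≡-Reasoning
    start = ℤ.- (+ length la)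
    N = length la + row la 1

theorem4p4 : (la mu : List ℕ) → IsPartition la → IsPartition mu → mu ⊆ₚ la →
    (IntervalSet la mu ↔ Fin (product (map suc (leftSnakeHalfLengths la mu))))
    × (IntervalSet la mu ↔ Fin (product (map suc (rightSnakeHalfLengths la mu))))
theorem4p4 la mu pl pm inc =
    enum⇒↔ (isIntervalSet la mu) (subst (λ n → Enumeration n (λ ps → T (isIntervalSet la mu ps))) left-product intervalSets)
  , enum⇒↔ (isIntervalSet la mu) (subst (λ n → Enumeration n (λ ps → T (isIntervalSet la mu ps))) right-product intervalSets)
  where
  open Skew la mu pl pm inc
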